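{- Let $\mathcal{A}=(A_1,\ldots,A_s)$ be any presentation of a transversal matroid $M$ with rank function $r$. Then $M$ is a fundamental transversal matroid if and only if $$r\Bigl(\bigcap_{F\in\mathcal{F}}F\Bigr)=\Bigl|\bigcap_{F\in\mathcal{F}}\Delta(F)\Bigr|$$ for every nonempty subset $\mathcal{F}$ of $\mathcal{Z}(M)$; equivalently, for every nonempty filter $\mathcal{F}$ of $\mathcal{Z}(M)$; equivalently, for every nonempty antichain $\mathcal{F}$ of $\mathcal{Z}(M)$.
   Context: Matroids have finite ground sets; $E(M)$ is the ground set of $M$. A set system on a set $S$ is a finite multiset $(A_1,\ldots,A_s)$ of subsets of $S$. A partial transversal of it is a subset $I\subseteq S$ for which there is an injection $\psi:I\to\{1,\ldots,s\}$ with $x\in A_{\psi(x)}$ for all $x\in I$. The partial transversals are the independent sets of a matroid on $S$; such a matroid is called transversal and the set system is a presentation of it. A fundamental transversal matroid is a transversal matroid that has a presentation $(B_1,\ldots,B_t)$ for which no difference $B_i-\bigcup_{j\ne i}B_j$, for $1\le i\le t$, is empty. (Equivalently, $M$ is a matroid having a fundamental basis, that is, a basis $B$ such that each $F\in\mathcal{Z}(M)$ is spanned by $B\cap F$.) Given the presentation $\mathcal{A}=(A_1,\ldots,A_s)$ and a simplex $\Delta$ with vertices $v_1,\ldots,v_s$ (distinct labels, one for each set of $\mathcal{A}$), for $x\in E(M)$ let $\Delta(x)=\{v_k: x\in A_k\}$, and for $X\subseteq E(M)$ let $\Delta(X)=\bigcup_{x\in X}\Delta(x)=\{v_k: X\cap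 A_k\neq\emptyset\}$. A set $X\subseteq E(M)$ is cyclic if it is a union of circuits of $M$ (the empty set is cyclic). $\mathcal{Z}(M)$ is the set of all cyclic flats of $M$, ordered by inclusion. An antichain in $\mathcal{Z}(M)$ is a subset no two of whose members are related by inclusion. A filter in $\mathcal{Z}(M)$ is a subset $\mathcal{F}\subseteq\mathcal{Z}(M)$ such that if $A\in\mathcal{F}$, $B\in\mathcal{Z}(M)$ and $A\subseteq B$, then $B\in\mathcal{F}$. -}

module Defs where

open import Data.Nat.Base using (ℕ; zero; suc; _<_)
open import Data.Fin.Base using (Fin)
open import Data.Fin.Properties using (_≟_)
open import Data.Fin.Subset
open import Data.Fin.Subset.Properties using (_∈?_; _⊆?_)
open import Data.List.Base using (List; []; _∷_; _++_; map; filter; allFin)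
open import Data.List.Extrema.Nat using (max)
open import Data.List.Membership.Propositional using () renaming (_∈_ to _∈ˡ_)
open import Data.List.Relation.Unary.All using (All)
import Data.Vec.Base as Vec
open import Data.Product.Base using (Σ; ∃; ∃-syntax; _×_; proj₁)
open import Function.Bundles using (_⇔_)
open import Function.Definitions using (Injective)
open import Level using (0ℓ)
open import Relation.Binary.PropositionalEquality using (_≡_; _≢_)
open import Relation.Nullary using (¬_)
open import Relation.Nullary.Decidable using (¬?; _×-dec_)
open import Relation.Unary using (Pred; Decidable)

subsets : ∀ n → List (Subset n)
subsets zero    = Vec.[] ∷ []
subsets (suc n) = map (outside Vec.∷_) (subsets n) ++ map (inside Vec.∷_) (subsets n)

-- Matroids on the ground set Fin n.  Independence is decidable, as it is
-- classically for any finite matroid; this lets rank be a function.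
record Matroid (n : ℕ) : Set₁ where
  field
    Indep      : Pred (Subset n) 0ℓ
    indep?     : Decidable Indep
    ⊥-indep    : Indep ⊥
    hereditary : ∀ {I J} → I ⊆ J → Indep J → Indep I
    augment    : ∀ {I J} → Indep I → Indep J → ∣ I ∣ < ∣ J ∣ →
                 ∃[ x ] x ∈ J × x ∉ I × Indep (I ∪ ⁅ x ⁆)

  rank : Subset n → ℕ
  rank X = max 0 (map ∣_∣ (filter (λ I → (I ⊆? X) ×-dec indep? I) (subsets n)))

  Circuit : Pred (Subset n) 0ℓ
  Circuit C = ¬ Indep C × (∀ D → D ⊂ C → Indep D)

  Cyclic : Pred (Subset n) 0ℓ
  Cyclic X = ∃[ Cs ] All Circuit Cs × X ≡ ⋃ Cs

  Flat : Pred (Subset n) 0ℓ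
  Flat F = ∀ {x} → rank (F ∪ ⁅ x ⁆) ≡ rank F → x ∈ F

  CyclicFlat : Pred (Subset n) 0ℓ
  CyclicFlat F = Cyclic F × Flat F

open Matroid public

-- A finite multiset of subsets of Fin n, as an indexed family.
SetSystem : ℕ → ℕ → Set
SetSystem n s = Fin s → Subset n

PartialTransversal : ∀ {n s} → SetSystem n s → Pred (Subset n) 0ℓ
PartialTransversal {n} {s} A I =
  Σ (∃ (_∈ I) → Fin s) λ ψ →
    Injective _≡_ _≡_ ψ × (∀ x → proj₁ x ∈ A (ψ x))

Presents : ∀ {n s} → SetSystem n s → Matroid n → Set
Presents A M = ∀ I → Indep M I ⇔ PartialTransversal A I

Fundamental : ∀ {n} → Matroid n → Set
Fundamental {n} M =
  ∃[ t ] Σ (SetSystem n t) λ B → Presents B M ×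
    (∀ i → Nonempty (B i ─ ⋃ (map B (filter (λ j → ¬? (j ≟ i)) (allFin t)))))

-- Faces of the simplex are identified with the subsets of its vertex set,
-- with vertex v_k written as the index k : Fin s.
Δ₁ : ∀ {n s} → SetSystem n s → Fin n → Subset s
Δ₁ A x = Vec.tabulate λ k → Vec.lookup (A k) x

Δ : ∀ {n s} → SetSystem n s → Subset n → Subset s
Δ {n} A X = ⋃ (map (Δ₁ A) (filter (_∈? X) (allFin n)))

-- A set of subsets of the (finite) ground set is given by a list of its
-- members; order and repetitions play no role below.
Family : ℕ → Set
Family n = List (Subset n)

NonemptyFamilyOfCyclicFlats : ∀ {n} → Matroid n → Pred (Family n) 0ℓ
NonemptyFamilyOfCyclicFlats M 𝓕 = 𝓕 ≢ [] × All (CyclicFlat M) 𝓕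

IsFilter : ∀ {n} → Matroid n → Pred (Family n) 0ℓ
IsFilter M 𝓕 = ∀ {F G} → F ∈ˡ 𝓕 → CyclicFlat M G → F ⊆ G → G ∈ˡ 𝓕

IsAntichain : ∀ {n} → Pred (Family n) 0ℓ
IsAntichain 𝓕 = ∀ {F G} → F ∈ˡ 𝓕 → G ∈ˡ 𝓕 → F ⊆ G → F ≡ G

RankEquality : ∀ {n s} → Matroid n → SetSystem n s → Pred (Family n) 0ℓ
RankEquality M A 𝓕 = rank M (⋂ 𝓕) ≡ ∣ ⋂ (map (Δ A) 𝓕) ∣

{-# OPTIONS --safe #-}

-- By Hall's theorem r(X) = ∣Δ(X)∣ for every cyclic set X, so inclusion–exclusion makes
-- ∣⋂ Δ(F)∣ independent of the presentation. If a presentation (Bₖ) has elements bₖ lying in Bₖ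
-- only, then k ∈ Δ(F) forces bₖ into the flat F, so the bₖ with k ∈ ⋂ Δ(F) are independent
-- in ⋂ F; this gives the equality. Conversely, let 𝓕 consist of the cyclic flats F with
-- k ∈ Δ(F), the star of k, which is a filter. The equality says that a basis of ⋂ 𝓕 is
-- matched onto ⋂ Δ(F) ∋ k, and the partner bₖ of k lies in exactly those cyclic flats F for
-- which k ∈ Δ(F). Hence ∣{bₖ} ∩ F∣ = ∣Δ(F)∣ = r(F): the set {bₖ} is independent and spans
-- every cyclic flat, and for a basis B containing it the sets {x : B - b + x is a basis},
-- b ∈ B, form the required presentation.
module Submission where

open import Defs
open import Data.Bool.Base using (true)
open import Data.Nat.Base using (ℕ; zero; suc; _+_; _≤_; _<_; z≤n; s≤s⁻¹)
import Data.Nat.Properties as ℕ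
open import Data.Fin.Base using (Fin; zero; suc)
import Data.Fin.Properties as Fin
open import Data.Fin.Subset
open import Data.Fin.Subset.Properties
open import Data.List.Base as List using (List; []; _∷_; map; filter; allFin; length)
import Data.List.Properties as List
open import Data.List.Extrema.Nat using (xs≤max; argmax-sel)
open import Data.List.Membership.Propositional using (find; lose) renaming (_∈_ to _∈ˡ_)
open import Data.List.Membership.Propositional.Properties
  using (∈-map⁺; ∈-map⁻; ∈-filter⁺; ∈-filter⁻; ∈-++⁺ˡ; ∈-++⁺ʳ; ∈-allFin; ∈-lookup)
open import Data.List.Relation.Unary.All as All using (All; []; _∷_)
import Data.List.Relation.Unary.All.Properties as All
open import Data.List.Relation.Unary.AllPairs using (_∷_)
open import Data.List.Relation.Unary.Any as Any using (Any; here; there; index)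
open import Data.List.Relation.Unary.Any.Properties using (lookup-index)
open import Data.List.Relation.Unary.Unique.Propositional using (Unique)
import Data.List.Relation.Unary.Unique.Propositional.Properties as Unique
open import Data.Product.Base using (Σ; ∃; ∃-syntax; _×_; _,_; proj₁; proj₂)
open import Data.Sum.Base using (_⊎_; inj₁; inj₂; [_,_]′)
import Data.Vec.Base as Vec
open import Data.Vec.Base using ([]; _∷_; here; there)
import Data.Vec.Properties as Vec
open import Data.Vec.Properties.WithK using ([]=-irrelevant)
open import Function.Base using (id; _∘_; _$_)
open import Function.Bundles using (_⇔_; mk⇔; Equivalence)
open import Level using (0ℓ)
open import Relation.Binary.PropositionalEquality
  using (_≡_; _≢_; refl; sym; trans; cong; cong₂; subst; module ≡-Reasoning)
open import Relation.Nullary using (¬_; Dec; yes; no; does; contradiction)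
open import Relation.Nullary.Decidable using (¬?; _×-dec_; _→-dec_; map′; decidable-stable)
open import Relation.Unary using (Pred; Decidable)

private
  variable
    m n s t : ℕ
    x y : Fin n
    p q X Y I J D : Subset n

-- Finite subsets: membership and cardinality.

select : {P : Pred (Fin n) 0ℓ} → Decidable P → Subset n
select P? = Vec.tabulate (does ∘ P?)

module _ {P : Pred (Fin n) 0ℓ} (P? : Decidable P) where

  ∈-select⁺ : P x → x ∈ select P?
  ∈-select⁺ {x = x} px = Vec.lookup⇒[]= x _ (trans (Vec.lookup∘tabulate _ x) (eq (P? x)))
    where
    eq : (d : Dec (P x)) → does d ≡ true
    eq (yes _)  = refl
    eq (no ¬px) = contradiction px ¬px

  ∈-select⁻ : x ∈ select P? → P x
  ∈-select⁻ {x = x} x∈ =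
    invert (P? x) (trans (sym (Vec.lookup∘tabulate _ x)) (Vec.[]=⇒lookup x∈))
    where
    invert : (d : Dec (P x)) → does d ≡ true → P x
    invert (yes px) _ = px

∈-⋃⁺ : ∀ {Xs : List (Subset n)} → X ∈ˡ Xs → x ∈ X → x ∈ ⋃ Xs
∈-⋃⁺ {Xs = Y ∷ Xs} (here refl) x∈X = p⊆p∪q (⋃ Xs) x∈X
∈-⋃⁺ {Xs = Y ∷ Xs} (there X∈)  x∈X = q⊆p∪q Y (⋃ Xs) (∈-⋃⁺ X∈ x∈X)

∈-⋃⁻ : ∀ (Xs : List (Subset n)) → x ∈ ⋃ Xs → ∃[ X ] X ∈ˡ Xs × x ∈ X
∈-⋃⁻ []       x∈ = contradiction x∈ ∉⊥
∈-⋃⁻ (Y ∷ Xs) x∈ with x∈p∪q⁻ Y (⋃ Xs) x∈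
... | inj₁ x∈Y = Y , here refl , x∈Y
... | inj₂ x∈⋃ with X , X∈ , x∈X ← ∈-⋃⁻ Xs x∈⋃ = X , there X∈ , x∈X

∈-⋂⁺ : ∀ (Xs : List (Subset n)) → (∀ {X} → X ∈ˡ Xs → x ∈ X) → x ∈ ⋂ Xs
∈-⋂⁺ []       _ = ∈⊤
∈-⋂⁺ (Y ∷ Xs) h = x∈p∩q⁺ (h (here refl) , ∈-⋂⁺ Xs (h ∘ there))

∈-⋂⁻ : ∀ {Xs : List (Subset n)} → x ∈ ⋂ Xs → X ∈ˡ Xs → x ∈ X
∈-⋂⁻ {Xs = Y ∷ Xs} x∈ (here refl) = proj₁ (x∈p∩q⁻ Y (⋂ Xs) x∈)
∈-⋂⁻ {Xs = Y ∷ Xs} x∈ (there X∈)  = ∈-⋂⁻ (proj₂ (x∈p∩q⁻ Y (⋂ Xs) x∈)) X∈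

∈-subsets : ∀ (p : Subset n) → p ∈ˡ subsets n
∈-subsets []            = here refl
∈-subsets (outside ∷ p) = ∈-++⁺ˡ (∈-map⁺ _ (∈-subsets p))
∈-subsets (inside  ∷ p) = ∈-++⁺ʳ (map (outside ∷_) (subsets _)) (∈-map⁺ _ (∈-subsets p))

lookup-injective : ∀ {A : Set} {xs : List A} → Unique xs →
  ∀ i j → List.lookup xs i ≡ List.lookup xs j → i ≡ j
lookup-injective (x∉ ∷ u) zero    zero    _  = refl
lookup-injective (x∉ ∷ u) zero    (suc j) eq = contradiction eq (All.lookup x∉ (∈-lookup j))
lookup-injective (x∉ ∷ u) (suc i) zero    eq = contradiction (sym eq) (All.lookup x∉ (∈-lookup i))
lookup-injective (x∉ ∷ u) (suc i) (suc j) eq = cong suc (lookup-injective u i j eq)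

∪-least : X ⊆ p → Y ⊆ p → X ∪ Y ⊆ p
∪-least {X = X} {Y = Y} X⊆p Y⊆p z∈ = [ X⊆p , Y⊆p ]′ (x∈p∪q⁻ X Y z∈)

insert-⊆ : X ⊆ p → x ∈ p → X ∪ ⁅ x ⁆ ⊆ p
insert-⊆ {p = p} {x = x} X⊆p x∈p =
  ∪-least X⊆p (λ z∈ → subst (_∈ p) (sym (x∈⁅y⁆⇒x≡y x z∈)) x∈p)

∪-mono : X ⊆ p → Y ⊆ q → X ∪ Y ⊆ p ∪ q
∪-mono {p = p} {q = q} X⊆p Y⊆q = ∪-least (p⊆p∪q q ∘ X⊆p) (q⊆p∪q p q ∘ Y⊆q)

∩-mono : X ⊆ p → Y ⊆ q → X ∩ Y ⊆ p ∩ q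
∩-mono {X = X} {Y = Y} X⊆p Y⊆q z∈ =
  let z∈X , z∈Y = x∈p∩q⁻ X Y z∈ in x∈p∩q⁺ (X⊆p z∈X , Y⊆q z∈Y)

x∈insert : ∀ (p : Subset n) x → x ∈ p ∪ ⁅ x ⁆
x∈insert p x = q⊆p∪q p _ (x∈⁅x⁆ x)

∈insert⁻ : ∀ (p : Subset n) → y ∈ p ∪ ⁅ x ⁆ → y ≢ x → y ∈ p
∈insert⁻ {x = x} p y∈ y≢x with x∈p∪q⁻ p ⁅ x ⁆ y∈
... | inj₁ y∈p = y∈p
... | inj₂ y∈x = contradiction (x∈⁅y⁆⇒x≡y x y∈x) y≢x

x∈p─q⇒x∉q : ∀ (p q : Subset n) → x ∈ p ─ q → x ∉ q
x∈p─q⇒x∉q (_ ∷ p) (outside ∷ q) (there x∈) (there x∈q) = x∈p─q⇒x∉q p q x∈ x∈q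
x∈p─q⇒x∉q (_ ∷ p) (inside  ∷ q) (there x∈) (there x∈q) = x∈p─q⇒x∉q p q x∈ x∈q

x∉p-x : ∀ (p : Subset n) x → x ∉ p - x
x∉p-x p x x∈ = x∈p─q⇒x∉q p ⁅ x ⁆ x∈ (x∈⁅x⁆ x)

p-x⊆p : ∀ (p : Subset n) x → p - x ⊆ p
p-x⊆p p x = p─q⊆p p ⁅ x ⁆

∈p-x⇒≢ : ∀ (p : Subset n) x → y ∈ p - x → y ≢ x
∈p-x⇒≢ p x y∈ refl = x∉p-x p x y∈

∣p∪q∣+∣p∩q∣≡∣p∣+∣q∣ : ∀ (p q : Subset n) → ∣ p ∪ q ∣ + ∣ p ∩ q ∣ ≡ ∣ p ∣ + ∣ q ∣
∣p∪q∣+∣p∩q∣≡∣p∣+∣q∣ []            []            = refl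
∣p∪q∣+∣p∩q∣≡∣p∣+∣q∣ (outside ∷ p) (outside ∷ q) = ∣p∪q∣+∣p∩q∣≡∣p∣+∣q∣ p q
∣p∪q∣+∣p∩q∣≡∣p∣+∣q∣ (outside ∷ p) (inside  ∷ q) =
  trans (cong suc (∣p∪q∣+∣p∩q∣≡∣p∣+∣q∣ p q)) (sym (ℕ.+-suc ∣ p ∣ ∣ q ∣))
∣p∪q∣+∣p∩q∣≡∣p∣+∣q∣ (inside  ∷ p) (outside ∷ q) = cong suc (∣p∪q∣+∣p∩q∣≡∣p∣+∣q∣ p q)
∣p∪q∣+∣p∩q∣≡∣p∣+∣q∣ (inside  ∷ p) (inside  ∷ q) = cong suc
  (trans (ℕ.+-suc ∣ p ∪ q ∣ ∣ p ∩ q ∣)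
    (trans (cong suc (∣p∪q∣+∣p∩q∣≡∣p∣+∣q∣ p q)) (sym (ℕ.+-suc ∣ p ∣ ∣ q ∣))))

∣p∩q∣+∣p─q∣≡∣p∣ : ∀ (p q : Subset n) → ∣ p ∩ q ∣ + ∣ p ─ q ∣ ≡ ∣ p ∣
∣p∩q∣+∣p─q∣≡∣p∣ []            []            = refl
∣p∩q∣+∣p─q∣≡∣p∣ (outside ∷ p) (outside ∷ q) = ∣p∩q∣+∣p─q∣≡∣p∣ p q
∣p∩q∣+∣p─q∣≡∣p∣ (outside ∷ p) (inside  ∷ q) = ∣p∩q∣+∣p─q∣≡∣p∣ p q
∣p∩q∣+∣p─q∣≡∣p∣ (inside  ∷ p) (outside ∷ q) =
  trans (ℕ.+-suc ∣ p ∩ q ∣ ∣ p ─ q ∣) (cong suc (∣p∩q∣+∣p─q∣≡∣p∣ p q))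
∣p∩q∣+∣p─q∣≡∣p∣ (inside  ∷ p) (inside  ∷ q) = cong suc (∣p∩q∣+∣p─q∣≡∣p∣ p q)

∣insert∣≤ : ∀ (p : Subset n) x → ∣ p ∪ ⁅ x ⁆ ∣ ≤ suc ∣ p ∣
∣insert∣≤ p x = begin
  ∣ p ∪ ⁅ x ⁆ ∣                     ≤⟨ ℕ.m≤m+n _ _ ⟩
  ∣ p ∪ ⁅ x ⁆ ∣ + ∣ p ∩ ⁅ x ⁆ ∣     ≡⟨ ∣p∪q∣+∣p∩q∣≡∣p∣+∣q∣ p ⁅ x ⁆ ⟩
  ∣ p ∣ + ∣ ⁅ x ⁆ ∣                 ≡⟨ cong (∣ p ∣ +_) (∣⁅x⁆∣≡1 x) ⟩
  ∣ p ∣ + 1                         ≡⟨ ℕ.+-comm ∣ p ∣ 1 ⟩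
  suc ∣ p ∣                         ∎
  where open ℕ.≤-Reasoning

∣insert∣> : x ∉ p → ∣ p ∣ < ∣ p ∪ ⁅ x ⁆ ∣
∣insert∣> {x = x} {p = p} x∉p = p⊂q⇒∣p∣<∣q∣ (p⊆p∪q ⁅ x ⁆ , x , x∈insert p x , x∉p)

⊆remove∪ : ∀ (p : Subset n) x → p ⊆ (p - x) ∪ ⁅ x ⁆
⊆remove∪ p x {y} y∈p with y Fin.≟ x
... | yes refl = x∈insert (p - x) x
... | no  y≢x  = p⊆p∪q _ (x∈p∧x≢y⇒x∈p-y y∈p y≢x)

∣p∣≤suc∣p-x∣ : ∀ (p : Subset n) x → ∣ p ∣ ≤ suc ∣ p - x ∣
∣p∣≤suc∣p-x∣ p x = ℕ.≤-trans (p⊆q⇒∣p∣≤∣q∣ (⊆remove∪ p x)) (∣insert∣≤ (p - x) x)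

⊆∧∣∣≥⇒⊇ : p ⊆ q → ∣ q ∣ ≤ ∣ p ∣ → q ⊆ p
⊆∧∣∣≥⇒⊇ {p = p} p⊆q ∣q∣≤∣p∣ {x} x∈q with x ∈? p
... | yes x∈p = x∈p
... | no  x∉p = contradiction (p⊂q⇒∣p∣<∣q∣ (p⊆q , x , x∈q , x∉p)) (ℕ.≤⇒≯ ∣q∣≤∣p∣)

-- The injection is given as a relation, which spares its users from forming
-- functions that depend on proofs of membership.
injection⇒∣p∣≤∣q∣ : (p : Subset m) (q : Subset n) (R : Fin m → Fin n → Set) →
  (∀ {x} → x ∈ p → ∃[ y ] y ∈ q × R x y) →
  (∀ {x x′ y} → R x y → R x′ y → x ≡ x′) → ∣ p ∣ ≤ ∣ q ∣
injection⇒∣p∣≤∣q∣ []            q R total inj = z≤n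
injection⇒∣p∣≤∣q∣ (outside ∷ p) q R total inj =
  injection⇒∣p∣≤∣q∣ p q (R ∘ suc) (total ∘ there) λ r r′ → Fin.suc-injective (inj r r′)
injection⇒∣p∣≤∣q∣ (inside ∷ p)  q R total inj with y₀ , y₀∈q , r₀ ← total here =
  ℕ.≤-<-trans
    (injection⇒∣p∣≤∣q∣ p (q - y₀) (R ∘ suc) total′ λ r r′ → Fin.suc-injective (inj r r′))
    (x∈p⇒∣p-x∣<∣p∣ y₀∈q)
  where
  total′ : ∀ {x} → x ∈ p → ∃[ y ] y ∈ q - y₀ × R (suc x) y
  total′ x∈p with y , y∈q , r ← total (there x∈p) =
    y , x∈p∧x≢y⇒x∈p-y y∈q (λ { refl → Fin.0≢1+n (inj r₀ r) }) , r

-- Set systems, matchings and Hall's theorem.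

module _ (A : SetSystem n s) where

  ∈-Δ₁⁺ : ∀ {k} → x ∈ A k → k ∈ Δ₁ A x
  ∈-Δ₁⁺ {x = x} {k} x∈ = Vec.lookup⇒[]= k _
    (trans (Vec.lookup∘tabulate _ k) (Vec.[]=⇒lookup x∈))

  ∈-Δ₁⁻ : ∀ {k} → k ∈ Δ₁ A x → x ∈ A k
  ∈-Δ₁⁻ {x = x} {k} k∈ = Vec.lookup⇒[]= x _
    (trans (sym (Vec.lookup∘tabulate _ k)) (Vec.[]=⇒lookup k∈))

  ∈-Δ⁺ : ∀ {k} → x ∈ X → x ∈ A k → k ∈ Δ A X
  ∈-Δ⁺ {x = x} {X = X} x∈X x∈Ak =
    ∈-⋃⁺ (∈-map⁺ (Δ₁ A) (∈-filter⁺ (_∈? X) (∈-allFin x) x∈X)) (∈-Δ₁⁺ x∈Ak)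

  ∈-Δ⁻ : ∀ {k} → k ∈ Δ A X → ∃[ x ] x ∈ X × x ∈ A k
  ∈-Δ⁻ {X = X} k∈
    with _ , Y∈ , k∈Y ← ∈-⋃⁻ (map (Δ₁ A) (filter (_∈? X) (allFin n))) k∈
    with x , x∈ , refl ← ∈-map⁻ (Δ₁ A) Y∈ =
    x , proj₂ (∈-filter⁻ (_∈? X) {xs = allFin n} x∈) , ∈-Δ₁⁻ k∈Y

  Δ-mono : X ⊆ Y → Δ A X ⊆ Δ A Y
  Δ-mono X⊆Y k∈ = let x , x∈X , x∈Ak = ∈-Δ⁻ k∈ in ∈-Δ⁺ (X⊆Y x∈X) x∈Ak

  Δ-∪ : ∀ X Y → Δ A (X ∪ Y) ≡ Δ A X ∪ Δ A Y
  Δ-∪ X Y = ⊆-antisym Δ∪⊆ (∪-least (Δ-mono (p⊆p∪q Y)) (Δ-mono (q⊆p∪q X Y)))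
    where
    Δ∪⊆ : Δ A (X ∪ Y) ⊆ Δ A X ∪ Δ A Y
    Δ∪⊆ k∈ with x , x∈ , x∈Ak ← ∈-Δ⁻ k∈ with x∈p∪q⁻ X Y x∈
    ... | inj₁ x∈X = p⊆p∪q _ (∈-Δ⁺ x∈X x∈Ak)
    ... | inj₂ x∈Y = q⊆p∪q (Δ A X) _ (∈-Δ⁺ x∈Y x∈Ak)

  Δ-⊥ : Δ A ⊥ ≡ ⊥
  Δ-⊥ = Empty-unique λ (k , k∈) → ∉⊥ (proj₁ (proj₂ (∈-Δ⁻ k∈)))

  Δ-⋂ : ∀ 𝓕 → Δ A (⋂ 𝓕) ⊆ ⋂ (map (Δ A) 𝓕)
  Δ-⋂ 𝓕 k∈ = ∈-⋂⁺ (map (Δ A) 𝓕) λ D∈ → let F , F∈ , D≡ = ∈-map⁻ (Δ A) D∈ in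
    subst (_ ∈_) (sym D≡) (Δ-mono (λ x∈ → ∈-⋂⁻ x∈ F∈) k∈)

  -- Confining the indices to `D` lets the proof of Hall's theorem delete an index once it is used,
  -- and turns a matching into `Δ A X` into a bound on `∣ I ∣`.
  record Matching (I : Subset n) (D : Subset s) : Set where
    field
      match     : x ∈ I → Fin s
      match∈D   : (x∈I : x ∈ I) → match x∈I ∈ D
      ∈match    : (x∈I : x ∈ I) → x ∈ A (match x∈I)
      injective : (x∈I : x ∈ I) (y∈I : y ∈ I) → match x∈I ≡ match y∈I → x ≡ y

    Matched : Fin n → Fin s → Set
    Matched x k = Σ (x ∈ I) λ x∈I → match x∈I ≡ k

    Matched⇒∈ : ∀ {k} → Matched x k → x ∈ A k
    Matched⇒∈ (x∈I , refl) = ∈match x∈I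

    Matched-injective : ∀ {k} → Matched x k → Matched y k → x ≡ y
    Matched-injective (x∈I , eq) (y∈I , eq′) = injective x∈I y∈I (trans eq (sym eq′))

    -- The partner could depend on the proof of `x ∈ I`; irrelevance of membership proofs rules this
    -- out.
    Matched-functional : ∀ {j k} → Matched x j → Matched x k → j ≡ k
    Matched-functional (x∈I , refl) (x∈I′ , refl) = cong match ([]=-irrelevant x∈I x∈I′)

    ∣I∣≤∣D∣ : ∣ I ∣ ≤ ∣ D ∣
    ∣I∣≤∣D∣ = injection⇒∣p∣≤∣q∣ I D Matched (λ x∈I → _ , match∈D x∈I , x∈I , refl)
      Matched-injective

    matched? : ∀ k → Decidable (λ x → Matched x k)
    matched? k x with x ∈? I
    ... | no  x∉I = no (x∉I ∘ proj₁)
    ... | yes x∈I = map′ (x∈I ,_)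
      (λ (x∈I′ , eq) → trans (cong match ([]=-irrelevant x∈I x∈I′)) eq) (match x∈I Fin.≟ k)

    -- A missed index `k` would leave an injection of `I` into `D - k`, which is smaller than `D`.
    onto : ∣ D ∣ ≤ ∣ I ∣ → ∀ {k} → k ∈ D → ∃[ x ] Matched x k
    onto ∣D∣≤∣I∣ {k} k∈D with Fin.any? (matched? k)
    ... | yes hit  = hit
    ... | no  miss = contradiction
      (ℕ.≤-<-trans
        (injection⇒∣p∣≤∣q∣ I (D - k) Matched
          (λ x∈I → _ , x∈p∧x≢y⇒x∈p-y (match∈D x∈I) (λ eq → miss (_ , x∈I , eq)) , x∈I , refl)
          Matched-injective)
        (x∈p⇒∣p-x∣<∣p∣ k∈D))
      (ℕ.≤⇒≯ ∣D∣≤∣I∣)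

  open Matching

  transversal⇒matching : PartialTransversal A I → I ⊆ X → Matching I (Δ A X)
  transversal⇒matching (ψ , ψ-inj , ∈ψ) I⊆X = record
    { match     = λ x∈I → ψ (_ , x∈I)
    ; match∈D   = λ x∈I → ∈-Δ⁺ (I⊆X x∈I) (∈ψ (_ , x∈I))
    ; ∈match    = λ x∈I → ∈ψ (_ , x∈I)
    ; injective = λ x∈I y∈I eq → cong proj₁ (ψ-inj eq)
    }

  matching⇒transversal : Matching I D → PartialTransversal A I
  matching⇒transversal {I = I} μ =
    (λ (x , x∈I) → match μ x∈I) , inj _ _ , λ (x , x∈I) → ∈match μ x∈I
    where
    inj : (a b : ∃ (_∈ I)) → match μ (proj₂ a) ≡ match μ (proj₂ b) → a ≡ b
    inj (x , x∈I) (y , y∈I) eq with refl ← injective μ x∈I y∈I eq =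
      cong (x ,_) ([]=-irrelevant x∈I y∈I)

  Hall : Subset n → Subset s → Set
  Hall I D = ∀ {X} → X ⊆ I → ∣ X ∣ ≤ ∣ Δ A X ∩ D ∣

  -- Under the Hall condition the reverse inequality always holds, so this is an equality. Only
  -- `X ∩ I` is counted because `X` may leave `I`: in `rank-cyclic` it contains elements outside the
  -- basis.
  Tight : Subset n → Subset s → Subset n → Set
  Tight I D X = ∣ Δ A X ∩ D ∣ ≤ ∣ X ∩ I ∣

  module _ (hall : Hall I D) where

    -- Starts the fold in `tight-⋃` and is the default for indices or elements that ask for no tight
    -- set.
    tight-⊥ : Tight I D ⊥
    tight-⊥ = subst (_≤ ∣ ⊥ ∩ I ∣) (sym ∣Δ⊥∩D∣≡0) z≤n
      where
      ∣Δ⊥∩D∣≡0 : ∣ Δ A ⊥ ∩ D ∣ ≡ 0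
      ∣Δ⊥∩D∣≡0 = trans (cong ∣_∣ (trans (cong (_∩ D) Δ-⊥) (∩-zeroˡ D))) (∣⊥∣≡0 s)

    -- The Hall condition on X ∩ Y ∩ I is what submodularity of X ↦ ∣ Δ A X ∩ D ∣ leaves over.
    tight-∪ : Tight I D X → Tight I D Y → Tight I D (X ∪ Y)
    tight-∪ {X = X} {Y = Y} tX tY = ℕ.+-cancelʳ-≤ ∣ P ∩ Q ∣ _ _ $ begin
      ∣ Δ A (X ∪ Y) ∩ D ∣ + ∣ P ∩ Q ∣          ≡⟨ cong (λ Z → ∣ Z ∩ D ∣ + ∣ P ∩ Q ∣) (Δ-∪ X Y) ⟩
      ∣ (Δ A X ∪ Δ A Y) ∩ D ∣ + ∣ P ∩ Q ∣
        ≡⟨ cong (λ Z → ∣ Z ∣ + ∣ P ∩ Q ∣) (∩-distribʳ-∪ D (Δ A X) (Δ A Y)) ⟩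
      ∣ P ∪ Q ∣ + ∣ P ∩ Q ∣                    ≡⟨ ∣p∪q∣+∣p∩q∣≡∣p∣+∣q∣ P Q ⟩
      ∣ P ∣ + ∣ Q ∣                            ≤⟨ ℕ.+-mono-≤ tX tY ⟩
      ∣ X ∩ I ∣ + ∣ Y ∩ I ∣                    ≡⟨ ∣p∪q∣+∣p∩q∣≡∣p∣+∣q∣ (X ∩ I) (Y ∩ I) ⟨
      ∣ (X ∩ I) ∪ (Y ∩ I) ∣ + ∣ (X ∩ I) ∩ (Y ∩ I) ∣
        ≤⟨ ℕ.+-mono-≤ (p⊆q⇒∣p∣≤∣q∣ (∪-least (∩-mono (p⊆p∪q Y) id) (∩-mono (q⊆p∪q X Y) id)))
             (hall (p∩q⊆q X I ∘ p∩q⊆p (X ∩ I) (Y ∩ I))) ⟩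
      ∣ (X ∪ Y) ∩ I ∣ + ∣ Δ A ((X ∩ I) ∩ (Y ∩ I)) ∩ D ∣
        ≤⟨ ℕ.+-monoʳ-≤ ∣ (X ∪ Y) ∩ I ∣ (p⊆q⇒∣p∣≤∣q∣ Δ∩⊆) ⟩
      ∣ (X ∪ Y) ∩ I ∣ + ∣ P ∩ Q ∣              ∎
      where
      open ℕ.≤-Reasoning
      P = Δ A X ∩ D
      Q = Δ A Y ∩ D

      Δ∩⊆ : Δ A ((X ∩ I) ∩ (Y ∩ I)) ∩ D ⊆ P ∩ Q
      Δ∩⊆ k∈ = x∈p∩q⁺
        ( ∩-mono (Δ-mono (p∩q⊆p X I ∘ p∩q⊆p (X ∩ I) (Y ∩ I))) id k∈
        , ∩-mono (Δ-mono (p∩q⊆p Y I ∘ p∩q⊆q (X ∩ I) (Y ∩ I))) id k∈ )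

    tight-⋃ : ∀ {U} (F : Fin m → Subset n) → (∀ i → Tight I D (F i)) → (∀ i → F i ⊆ U) →
      ∃[ Y ] Tight I D Y × Y ⊆ U × (∀ i → F i ⊆ Y)
    tight-⋃ {m = m} F tight F⊆U = ⋃ Fs ,
      List.foldr-preservesᵇ {P = Tight I D} tight-∪ tight-⊥
        (All.map⁺ (All.tabulate {xs = allFin m} λ {i} _ → tight i)) ,
      (λ x∈ → let X , X∈ , x∈X = ∈-⋃⁻ Fs x∈
                  i , _ , X≡ = ∈-map⁻ F X∈
              in F⊆U i (subst (_ ∈_) X≡ x∈X)) ,
      λ i → ∈-⋃⁺ (∈-map⁺ F (∈-allFin i))
      where Fs = map F (allFin m)

  Violator : Subset n → Subset s → Set
  Violator I D = ∃[ X ] X ⊆ I × ∣ Δ A X ∩ D ∣ < ∣ X ∣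

  violator? : ∀ I D → Dec (Violator I D)
  violator? I D = anySubset? λ X → (X ⊆? I) ×-dec (∣ Δ A X ∩ D ∣ ℕ.<? ∣ X ∣)

  no-violator⇒hall : ¬ Violator I D → Hall I D
  no-violator⇒hall ¬v X⊆I = ℕ.≮⇒≥ λ lt → ¬v (_ , X⊆I , lt)

  extend-matching : ∀ {k} → x ∈ I → x ∈ A k → k ∈ D → Matching (I - x) (D - k) → Matching I D
  extend-matching {x = x} {I = I} {D = D} {k = k} x∈I x∈Ak k∈D μ = record
    { match     = λ y∈I → f (split y∈I)
    ; match∈D   = λ y∈I → f∈D (split y∈I)
    ; ∈match    = λ y∈I → ∈f (split y∈I)
    ; injective = λ y∈I z∈I → f-inj (split y∈I) (split z∈I)
    }
    where
    split : y ∈ I → y ≡ x ⊎ y ∈ I - x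
    split {y = y} y∈I with y Fin.≟ x
    ... | yes y≡x = inj₁ y≡x
    ... | no  y≢x = inj₂ (x∈p∧x≢y⇒x∈p-y y∈I y≢x)

    f : y ≡ x ⊎ y ∈ I - x → Fin s
    f (inj₁ _) = k
    f (inj₂ a) = match μ a

    f∈D : (a : y ≡ x ⊎ y ∈ I - x) → f a ∈ D
    f∈D (inj₁ _) = k∈D
    f∈D (inj₂ a) = p-x⊆p D k (match∈D μ a)

    ∈f : (a : y ≡ x ⊎ y ∈ I - x) → y ∈ A (f a)
    ∈f (inj₁ refl) = x∈Ak
    ∈f (inj₂ a)    = ∈match μ a

    f-inj : ∀ {z} (a : y ≡ x ⊎ y ∈ I - x) (b : z ≡ x ⊎ z ∈ I - x) → f a ≡ f b → y ≡ z
    f-inj (inj₁ refl) (inj₁ refl) _  = refl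
    f-inj (inj₁ _)    (inj₂ b)    eq = contradiction (sym eq) (∈p-x⇒≢ D k (match∈D μ b))
    f-inj (inj₂ a)    (inj₁ _)    eq = contradiction eq (∈p-x⇒≢ D k (match∈D μ a))
    f-inj (inj₂ a)    (inj₂ b)    eq = injective μ a b eq

  -- If no choice of partner for x leaves a matchable rest, the violators found for
  -- the various partners are tight, and adding x to their union violates the Hall condition.
  matching-or-violator : ∀ I D → Matching I D ⊎ Violator I D
  matching-or-violator I D = go ∣ I ∣ I D ℕ.≤-refl
    where
    go : ∀ m I D → ∣ I ∣ ≤ m → Matching I D ⊎ Violator I D
    go m I D ∣I∣≤m with violator? I D | nonempty? I
    ... | yes v | _ = inj₂ v
    ... | no ¬v | no empty = inj₁ record
      { match     = λ x∈I → contradiction (_ , x∈I) empty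
      ; match∈D   = λ x∈I → contradiction (_ , x∈I) empty
      ; ∈match    = λ x∈I → contradiction (_ , x∈I) empty
      ; injective = λ x∈I → contradiction (_ , x∈I) empty
      }
    go zero I D ∣I∣≤0 | no ¬v | yes (x , x∈I) =
      contradiction (ℕ.<-≤-trans (x∈p⇒∣p-x∣<∣p∣ x∈I) ∣I∣≤0) ℕ.n≮0
    go (suc m) I D ∣I∣≤1+m | no ¬v | yes (x , x∈I) = decide search
      where
      Obstruction : Fin s → Set
      Obstruction k = ∃[ X ] Tight I D X × X ⊆ I - x × (k ∈ D → x ∈ A k → k ∈ Δ A X)

      hall : Hall I D
      hall = no-violator⇒hall ¬v

      obstruct : ∀ {k} → Violator (I - x) (D - k) → Obstruction k
      obstruct {k} (X , X⊆ , lt) = X , tight , X⊆ , λ k∈D _ → k∈Δ k∈D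
        where
        X⊆I : X ⊆ I
        X⊆I = p-x⊆p I x ∘ X⊆

        -- Putting `k` back adds at most one index, which the strict inequality of the violator
        -- absorbs.
        tight : Tight I D X
        tight = begin
          ∣ Δ A X ∩ D ∣               ≤⟨ p⊆q⇒∣p∣≤∣q∣ remove ⟩
          ∣ Δ A X ∩ (D - k) ∪ ⁅ k ⁆ ∣ ≤⟨ ∣insert∣≤ (Δ A X ∩ (D - k)) k ⟩
          suc ∣ Δ A X ∩ (D - k) ∣     ≤⟨ lt ⟩
          ∣ X ∣                       ≤⟨ p⊆q⇒∣p∣≤∣q∣ (λ y∈ → x∈p∩q⁺ (y∈ , X⊆I y∈)) ⟩
          ∣ X ∩ I ∣                   ∎
          where
          open ℕ.≤-Reasoning
          remove : Δ A X ∩ D ⊆ Δ A X ∩ (D - k) ∪ ⁅ k ⁆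
          remove {j} j∈ with j Fin.≟ k | x∈p∩q⁻ (Δ A X) D j∈
          ... | yes refl | _           = x∈insert _ k
          ... | no  j≢k  | j∈Δ , j∈D = p⊆p∪q _ (x∈p∩q⁺ (j∈Δ , x∈p∧x≢y⇒x∈p-y j∈D j≢k))

        -- If `k` were not in `Δ A X`, deleting it from `D` would change nothing, and `X` would
        -- already violate the Hall condition for `I` and `D`.
        k∈Δ : k ∈ D → k ∈ Δ A X
        k∈Δ k∈D with k ∈? Δ A X
        ... | yes k∈ = k∈
        ... | no  k∉ = contradiction
          (ℕ.≤-trans (hall X⊆I) (p⊆q⇒∣p∣≤∣q∣ avoid)) (ℕ.<⇒≱ lt)
          where
          avoid : Δ A X ∩ D ⊆ Δ A X ∩ (D - k)
          avoid j∈ = let j∈Δ , j∈D = x∈p∩q⁻ (Δ A X) D j∈ in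
            x∈p∩q⁺ (j∈Δ , x∈p∧x≢y⇒x∈p-y j∈D λ { refl → k∉ j∈Δ })

      search : ∀ k → Matching I D ⊎ Obstruction k
      search k with k ∈? D | x ∈? A k
      ... | no k∉D | _ = inj₂ (⊥ , tight-⊥ hall , ⊥⊆ , λ k∈D → contradiction k∈D k∉D)
      ... | _ | no x∉Ak = inj₂ (⊥ , tight-⊥ hall , ⊥⊆ , λ _ x∈Ak → contradiction x∈Ak x∉Ak)
      ... | yes k∈D | yes x∈Ak
        with go m (I - x) (D - k) (s≤s⁻¹ (ℕ.≤-trans (x∈p⇒∣p-x∣<∣p∣ x∈I) ∣I∣≤1+m))
      ... | inj₁ μ = inj₁ (extend-matching x∈I x∈Ak k∈D μ)
      ... | inj₂ v = inj₂ (obstruct v)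

      decide : (∀ k → Matching I D ⊎ Obstruction k) → Matching I D ⊎ Violator I D
      decide search with choose search
        where
        choose : ∀ {m} {P : Set} {Q : Fin m → Set} → (∀ k → P ⊎ Q k) → P ⊎ (∀ k → Q k)
        choose {zero}  f = inj₂ λ ()
        choose {suc m} f with f zero | choose (f ∘ suc)
        ... | inj₁ p | _      = inj₁ p
        ... | _      | inj₁ p = inj₁ p
        ... | inj₂ q | inj₂ r = inj₂ λ { zero → q ; (suc k) → r k }
      ... | inj₁ μ = inj₁ μ
      ... | inj₂ obstructions
        with Y , tight , Y⊆ , ⊆Y ← tight-⋃ hall (proj₁ ∘ obstructions)
               (proj₁ ∘ proj₂ ∘ obstructions) (proj₁ ∘ proj₂ ∘ proj₂ ∘ obstructions) =
        contradiction (Y ∪ ⁅ x ⁆ , (λ {_} → insert-⊆ (p-x⊆p I x ∘ Y⊆) x∈I) , lt) ¬v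
        where
        x∉Y : x ∉ Y
        x∉Y x∈Y = x∉p-x I x (Y⊆ x∈Y)

        -- Each possible partner `k` of `x` lies in `Δ` of its own obstruction, hence in `Δ A Y`; so
        -- `x` enlarges the set but contributes no new index.
        Δ⊆ : Δ A (Y ∪ ⁅ x ⁆) ∩ D ⊆ Δ A Y ∩ D
        Δ⊆ {k} k∈ with k∈Δ , k∈D ← x∈p∩q⁻ (Δ A (Y ∪ ⁅ x ⁆)) D k∈
          with x∈p∪q⁻ (Δ A Y) _ (subst (k ∈_) (Δ-∪ Y ⁅ x ⁆) k∈Δ)
        ... | inj₁ k∈ΔY = x∈p∩q⁺ (k∈ΔY , k∈D)
        ... | inj₂ k∈Δx with x′ , x′∈ , x∈Ak ← ∈-Δ⁻ k∈Δx with refl ← x∈⁅y⁆⇒x≡y x x′∈ =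
          x∈p∩q⁺ (Δ-mono (⊆Y k) (proj₂ (proj₂ (proj₂ (obstructions k))) k∈D x∈Ak) , k∈D)

        lt : ∣ Δ A (Y ∪ ⁅ x ⁆) ∩ D ∣ < ∣ Y ∪ ⁅ x ⁆ ∣
        lt = ℕ.≤-<-trans (p⊆q⇒∣p∣≤∣q∣ Δ⊆)
          (ℕ.≤-<-trans tight (ℕ.≤-<-trans (∣p∩q∣≤∣p∣ Y I) (∣insert∣> x∉Y)))

  hall⇒transversal : (∀ {X} → X ⊆ I → ∣ X ∣ ≤ ∣ Δ A X ∣) → PartialTransversal A I
  hall⇒transversal {I = I} hall with matching-or-violator I ⊤
  ... | inj₁ μ = matching⇒transversal μ
  ... | inj₂ (X , X⊆I , lt) = contradiction (hall X⊆I)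
    (ℕ.<⇒≱ (subst (λ Y → ∣ Y ∣ < ∣ X ∣) (∩-identityʳ (Δ A X)) lt))

-- Rank, bases, circuits and cyclic flats of a matroid.

module _ (M : Matroid n) where

  private
    candidate? : ∀ X → Decidable (λ I → I ⊆ X × Indep M I)
    candidate? X I = (I ⊆? X) ×-dec indep? M I

    candidates : Subset n → List (Subset n)
    candidates X = filter (candidate? X) (subsets n)

  rank-max : I ⊆ X → Indep M I → ∣ I ∣ ≤ rank M X
  rank-max {I = I} {X = X} I⊆X ind =
    All.lookup (xs≤max 0 (map ∣_∣ (candidates X)))
      (∈-map⁺ ∣_∣ (∈-filter⁺ (candidate? X) (∈-subsets I) (I⊆X , ind)))

  Basis : Subset n → Subset n → Set
  Basis X I = I ⊆ X × Indep M I × ∣ I ∣ ≡ rank M X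

  basis : ∀ X → ∃ (Basis X)
  basis X with argmax-sel id 0 (map ∣_∣ (candidates X))
  -- Here the maximum is the default value 0 of `max`, attained by the empty set.
  ... | inj₁ ≡0 = ⊥ , ⊥⊆ , ⊥-indep M , trans (∣⊥∣≡0 n) (sym ≡0)
  ... | inj₂ r∈ with I , I∈ , r≡ ← ∈-map⁻ ∣_∣ r∈
    with _ , I⊆X , ind ← ∈-filter⁻ (candidate? X) {xs = subsets n} I∈ =
    I , (λ {_} → I⊆X) , ind , sym r≡

  rank-mono : X ⊆ Y → rank M X ≤ rank M Y
  rank-mono {X = X} {Y = Y} X⊆Y with I , I⊆X , ind , ∣I∣≡ ← basis X =
    subst (_≤ rank M Y) ∣I∣≡ (rank-max (X⊆Y ∘ I⊆X) ind)

  dependent⇒rank< : ¬ Indep M X → rank M X < ∣ X ∣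
  dependent⇒rank< {X = X} dep with I , I⊆X , ind , ∣I∣≡ ← basis X = subst (_< ∣ X ∣) ∣I∣≡
    (ℕ.≰⇒> λ ∣X∣≤∣I∣ → dep (hereditary M (⊆∧∣∣≥⇒⊇ I⊆X ∣X∣≤∣I∣) ind))

  extend-to-basis : I ⊆ X → Indep M I → ∃[ J ] I ⊆ J × Basis X J
  extend-to-basis {I = I} {X = X} I⊆X ind = go (rank M X) I I⊆X ind (ℕ.m≤m+n _ _)
    where
    -- `d` bounds the number of augmentations left; each of them raises `∣ I ∣`.
    go : ∀ d I → I ⊆ X → Indep M I → rank M X ≤ d + ∣ I ∣ → ∃[ J ] I ⊆ J × Basis X J
    go d I I⊆X ind bound with ∣ I ∣ ℕ.<? rank M X
    ... | no ∣I∣≮ = I , id , I⊆X , ind , ℕ.≤-antisym (rank-max I⊆X ind) (ℕ.≮⇒≥ ∣I∣≮)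
    go zero I I⊆X ind bound | yes lt = contradiction bound (ℕ.<⇒≱ lt)
    go (suc d) I I⊆X ind bound | yes lt
      with K , K⊆X , indK , ∣K∣≡ ← basis X
      with x , x∈K , x∉I , indIx ← augment M ind indK (subst (∣ I ∣ <_) (sym ∣K∣≡) lt)
      with J , ⊆J , bas ← go d (I ∪ ⁅ x ⁆) (insert-⊆ I⊆X (K⊆X x∈K)) indIx
             (ℕ.≤-trans bound (ℕ.≤-trans (ℕ.≤-reflexive (sym (ℕ.+-suc d ∣ I ∣)))
               (ℕ.+-monoʳ-≤ d (∣insert∣> x∉I)))) =
      J , (λ x∈I → ⊆J (p⊆p∪q ⁅ x ⁆ x∈I)) , bas

  -- Elements are deleted as long as the rest stays dependent. Once every single deletion gives an
  -- independent set, heredity covers all proper subsets.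
  dependent⇒circuit : ¬ Indep M X → ∃[ C ] C ⊆ X × Circuit M C
  dependent⇒circuit {X = X} = go ∣ X ∣ X ℕ.≤-refl
    where
    go : ∀ m X → ∣ X ∣ ≤ m → ¬ Indep M X → ∃[ C ] C ⊆ X × Circuit M C
    go m X bound dep with Fin.any? (λ x → (x ∈? X) ×-dec ¬? (indep? M (X - x)))
    ... | no minimal = X , id , dep , λ D (D⊆X , x , x∈X , x∉D) →
      hereditary M (λ y∈D → x∈p∧x≢y⇒x∈p-y (D⊆X y∈D) λ { refl → x∉D y∈D })
        (decidable-stable (indep? M (X - x)) λ dep′ → minimal (x , x∈X , dep′))
    go zero X bound dep | yes (x , x∈X , _) =
      contradiction (ℕ.<-≤-trans (x∈p⇒∣p-x∣<∣p∣ x∈X) bound) ℕ.n≮0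
    go (suc m) X bound dep | yes (x , x∈X , dep′)
      with C , C⊆ , circ ← go m (X - x) (s≤s⁻¹ (ℕ.≤-trans (x∈p⇒∣p-x∣<∣p∣ x∈X) bound)) dep′ =
      C , (λ y∈C → p-x⊆p X x (C⊆ y∈C)) , circ

  circuit? : Decidable (Circuit M)
  circuit? C = ¬? (indep? M C) ×-dec map′
    (λ none D D⊂C → decidable-stable (indep? M D) λ dep → none (D , D⊂C , dep))
    (λ all (D , D⊂C , dep) → dep (all D D⊂C))
    (¬? (anySubset? λ D → (D ⊂? C) ×-dec ¬? (indep? M D)))

  CircuitIn : Subset n → Pred (Subset n) 0ℓ
  CircuitIn X C = Circuit M C × C ⊆ X

  circuitIn? : ∀ X → Decidable (CircuitIn X)
  circuitIn? X C = circuit? C ×-dec (C ⊆? X)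

  -- With `cyclic⁺`, this trades the list of circuits for a pointwise covering, which can be decided
  -- by search and passes to unions.
  cyclic⁻ : Cyclic M X → x ∈ X → ∃[ C ] CircuitIn X C × x ∈ C
  cyclic⁻ (Cs , circuits , refl) x∈X with C , C∈ , x∈C ← ∈-⋃⁻ Cs x∈X =
    C , (All.lookup circuits C∈ , ∈-⋃⁺ C∈) , x∈C

  cyclic⁺ : (∀ {x} → x ∈ X → ∃[ C ] CircuitIn X C × x ∈ C) → Cyclic M X
  cyclic⁺ {X = X} covered = Cs , All.map proj₁ all-in , ⊆-antisym X⊆⋃ ⋃⊆X
    where
    Cs = filter (circuitIn? X) (subsets n)

    all-in : All (CircuitIn X) Cs
    all-in = All.all-filter (circuitIn? X) (subsets n)

    X⊆⋃ : X ⊆ ⋃ Cs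
    X⊆⋃ x∈X = let C , C-in , x∈C = covered x∈X in
      ∈-⋃⁺ (∈-filter⁺ (circuitIn? X) (∈-subsets C) C-in) x∈C

    ⋃⊆X : ⋃ Cs ⊆ X
    ⋃⊆X x∈ = let C , C∈ , x∈C = ∈-⋃⁻ Cs x∈ in proj₂ (All.lookup all-in C∈) x∈C

  cyclic-∪ : Cyclic M X → Cyclic M Y → Cyclic M (X ∪ Y)
  cyclic-∪ {X = X} {Y = Y} cX cY = cyclic⁺ covered
    where
    covered : x ∈ X ∪ Y → ∃[ C ] CircuitIn (X ∪ Y) C × x ∈ C
    covered x∈ with x∈p∪q⁻ X Y x∈
    ... | inj₁ x∈X = let C , (circ , C⊆) , x∈C = cyclic⁻ cX x∈X in
      C , (circ , λ y∈ → p⊆p∪q Y (C⊆ y∈)) , x∈C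
    ... | inj₂ x∈Y = let C , (circ , C⊆) , x∈C = cyclic⁻ cY x∈Y in
      C , (circ , λ y∈ → q⊆p∪q X Y (C⊆ y∈)) , x∈C

  cyclic? : Decidable (Cyclic M)
  cyclic? X = map′ cyclic⁺ (λ c → cyclic⁻ c) (map′
    (λ all {x} x∈X → all x x∈X) (λ covered x x∈X → covered x∈X)
    (Fin.all? λ x → (x ∈? X) →-dec anySubset? λ C → circuitIn? X C ×-dec (x ∈? C)))

  flat? : Decidable (Flat M)
  flat? F = map′ (λ all {x} → all x) (λ flat x → flat {x})
    (Fin.all? λ x → (rank M (F ∪ ⁅ x ⁆) ℕ.≟ rank M F) →-dec (x ∈? F))

  cyclicFlat? : Decidable (CyclicFlat M)
  cyclicFlat? F = cyclic? F ×-dec flat? F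

  closure : Subset n → Subset n
  closure X = select λ x → rank M (X ∪ ⁅ x ⁆) ℕ.≟ rank M X

  ∈-closure⁺ : rank M (X ∪ ⁅ x ⁆) ≡ rank M X → x ∈ closure X
  ∈-closure⁺ {X = X} = ∈-select⁺ λ x → rank M (X ∪ ⁅ x ⁆) ℕ.≟ rank M X

  ∈-closure⁻ : x ∈ closure X → rank M (X ∪ ⁅ x ⁆) ≡ rank M X
  ∈-closure⁻ {X = X} = ∈-select⁻ λ x → rank M (X ∪ ⁅ x ⁆) ℕ.≟ rank M X

  ⊆-closure : X ⊆ closure X
  ⊆-closure {x = x} x∈X = ∈-closure⁺
    (cong (rank M) (⊆-antisym (insert-⊆ id x∈X) (p⊆p∪q ⁅ x ⁆)))

  basis∪∈closure-dependent : Basis X I → x ∈ closure X → x ∉ I → ¬ Indep M (I ∪ ⁅ x ⁆)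
  basis∪∈closure-dependent {X = X} {x = x} (I⊆X , _ , ∣I∣≡) x∈cl x∉I ind = contradiction
    (ℕ.<-≤-trans (∣insert∣> x∉I) (rank-max (∪-mono I⊆X id) ind))
    (ℕ.≤⇒≯ (ℕ.≤-reflexive (trans (∈-closure⁻ x∈cl) (sym ∣I∣≡))))

  -- A larger independent set in the closure would augment a basis of `X` by an element of the
  -- closure, but any such addition makes the basis dependent.
  rank-closure : ∀ X → rank M (closure X) ≡ rank M X
  rank-closure X = ℕ.≤-antisym (ℕ.≮⇒≥ not-larger) (rank-mono ⊆-closure)
    where
    not-larger : ¬ rank M X < rank M (closure X)
    not-larger lt with I , bas@(_ , ind , ∣I∣≡) ← basis X | J , J⊆ , indJ , ∣J∣≡ ← basis (closure X)
      with x , x∈J , x∉I , indIx ← augment M ind indJ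
             (subst (_< ∣ J ∣) (sym ∣I∣≡) (subst (rank M X <_) (sym ∣J∣≡) lt)) =
      basis∪∈closure-dependent bas (J⊆ x∈J) x∉I indIx

  closure-flat : ∀ X → Flat M (closure X)
  closure-flat X {x} eq = ∈-closure⁺ (ℕ.≤-antisym
    (ℕ.≤-trans (rank-mono (∪-mono ⊆-closure id))
      (ℕ.≤-reflexive (trans eq (rank-closure X))))
    (rank-mono (p⊆p∪q ⁅ x ⁆)))

  -- Supplies the cyclic flats on which dependent sets are tested. An element `x` of the closure
  -- outside `C`, added to a basis of `C`, creates a circuit; this passes through `x` because the
  -- basis is independent.
  closure-circuit : ∀ {C} → Circuit M C → CyclicFlat M (closure C)
  closure-circuit {C = C} circ = cyclic⁺ covered , closure-flat C
    where
    covered : x ∈ closure C → ∃[ D ] CircuitIn (closure C) D × x ∈ D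
    covered {x} x∈cl with x ∈? C
    ... | yes x∈C = C , (circ , ⊆-closure) , x∈C
    ... | no  x∉C with I , bas@(I⊆C , ind , _) ← basis C
      with D , D⊆ , circD ← dependent⇒circuit
             (basis∪∈closure-dependent bas x∈cl (x∉C ∘ I⊆C)) =
      D , (circD , λ y∈D → insert-⊆ (⊆-closure ∘ I⊆C) x∈cl (D⊆ y∈D)) , x∈D
      where
      x∈D : x ∈ D
      x∈D = decidable-stable (x ∈? D) λ x∉D → proj₁ circD
        (hereditary M (λ y∈D → ∈insert⁻ I (D⊆ y∈D) λ { refl → x∉D y∈D }) ind)

-- Rank of cyclic sets and inclusion-exclusion.

∣⋂Δ∣ : SetSystem n s → Family n → Subset n → ℕ
∣⋂Δ∣ A 𝓕 U = ∣ ⋂ (map (Δ A) 𝓕) ∪ Δ A U ∣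

module _ (M : Matroid n) (A : SetSystem n s) (pres : Presents A M) where

  indep⇒∣∣≤∣Δ∣ : Indep M I → I ⊆ X → ∣ I ∣ ≤ ∣ Δ A X ∣
  indep⇒∣∣≤∣Δ∣ {I = I} ind I⊆X =
    Matching.∣I∣≤∣D∣ (transversal⇒matching A (Equivalence.to (pres I) ind) I⊆X)

  rank≤∣Δ∣ : ∀ X → rank M X ≤ ∣ Δ A X ∣
  rank≤∣Δ∣ X with I , I⊆X , ind , ∣I∣≡ ← basis M X =
    subst (_≤ ∣ Δ A X ∣) ∣I∣≡ (indep⇒∣∣≤∣Δ∣ ind I⊆X)

  dependent⇒violator : ¬ Indep M X → ∃[ Y ] Y ⊆ X × ∣ Δ A Y ∣ < ∣ Y ∣
  dependent⇒violator {X = X} dep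
    with anySubset? (λ Y → (Y ⊆? X) ×-dec (∣ Δ A Y ∣ ℕ.<? ∣ Y ∣))
  ... | yes v = v
  ... | no ¬v = contradiction
    (Equivalence.from (pres X) (hall⇒transversal A λ Y⊆X → ℕ.≮⇒≥ λ lt → ¬v (_ , Y⊆X , lt))) dep

  -- Every element of Z outside a basis K lies in a tight set. In the union T of these,
  -- K ∩ T spans T and each element of K ─ T is a coloop of Z; as Z is cyclic, T = Z.
  rank-cyclic : Cyclic M X → rank M X ≡ ∣ Δ A X ∣
  rank-cyclic {X = Z} cyc = ℕ.≤-antisym (rank≤∣Δ∣ Z) ∣ΔZ∣≤rank
    where
    K : Subset n
    K = proj₁ (basis M Z)

    K⊆Z : K ⊆ Z
    K⊆Z = proj₁ (proj₂ (basis M Z))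

    indep-K : Indep M K
    indep-K = proj₁ (proj₂ (proj₂ (basis M Z)))

    ∣K∣≡rank : ∣ K ∣ ≡ rank M Z
    ∣K∣≡rank = proj₂ (proj₂ (proj₂ (basis M Z)))

    ∣Δ∩⊤∣ : ∀ T → ∣ Δ A T ∩ ⊤ ∣ ≡ ∣ Δ A T ∣
    ∣Δ∩⊤∣ T = cong ∣_∣ (∩-identityʳ (Δ A T))

    hall : Hall A K ⊤
    hall {T} T⊆K = subst (∣ T ∣ ≤_) (sym (∣Δ∩⊤∣ T)) (indep⇒∣∣≤∣Δ∣ (hereditary M T⊆K indep-K) id)

    dependent : x ∈ Z → x ∉ K → ¬ Indep M (K ∪ ⁅ x ⁆)
    dependent x∈Z x∉K ind = contradiction
      (ℕ.<-≤-trans (∣insert∣> x∉K) (rank-max M (insert-⊆ K⊆Z x∈Z) ind))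
      (ℕ.≤⇒≯ (ℕ.≤-reflexive (sym ∣K∣≡rank)))

    tight-around : ∀ x → ∃[ T ] Tight A K ⊤ T × T ⊆ Z × (x ∈ Z → x ∉ K → x ∈ T)
    tight-around x with x ∈? Z | x ∈? K
    ... | no x∉Z | _ = ⊥ , tight-⊥ A hall , ⊥⊆ , λ x∈Z → contradiction x∈Z x∉Z
    ... | _ | yes x∈K = ⊥ , tight-⊥ A hall , ⊥⊆ , λ _ x∉K → contradiction x∈K x∉K
    -- A violator inside `K ∪ ⁅ x ⁆` contains `x`, since the independent set `K` has none. Dropping
    -- `x` uses up the strict inequality, so the violator is tight.
    ... | yes x∈Z | no x∉K with T , T⊆ , lt ← dependent⇒violator (dependent x∈Z x∉K) =
      T , tight , (λ y∈T → insert-⊆ K⊆Z x∈Z (T⊆ y∈T)) , λ _ _ → x∈T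
      where
      x∈T : x ∈ T
      x∈T = decidable-stable (x ∈? T) λ x∉T → contradiction
        (indep⇒∣∣≤∣Δ∣ (hereditary M (λ y∈T → ∈insert⁻ K (T⊆ y∈T) λ { refl → x∉T y∈T }) indep-K) id)
        (ℕ.<⇒≱ lt)

      tight : Tight A K ⊤ T
      tight = begin
        ∣ Δ A T ∩ ⊤ ∣   ≡⟨ ∣Δ∩⊤∣ T ⟩
        ∣ Δ A T ∣       ≤⟨ s≤s⁻¹ (ℕ.≤-trans lt (∣p∣≤suc∣p-x∣ T x)) ⟩
        ∣ T - x ∣       ≤⟨ p⊆q⇒∣p∣≤∣q∣ remove ⟩
        ∣ T ∩ K ∣       ∎
        where
        open ℕ.≤-Reasoning
        remove : T - x ⊆ T ∩ K
        remove y∈ = let y∈T = p-x⊆p T x y∈ in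
          x∈p∩q⁺ (y∈T , ∈insert⁻ K (T⊆ y∈T) (∈p-x⇒≢ T x y∈))

    union = tight-⋃ A hall (proj₁ ∘ tight-around)
      (proj₁ ∘ proj₂ ∘ tight-around) (proj₁ ∘ proj₂ ∘ proj₂ ∘ tight-around)

    T : Subset n
    T = proj₁ union

    T-tight : ∣ Δ A T ∣ ≤ ∣ T ∩ K ∣
    T-tight = subst (_≤ ∣ T ∩ K ∣) (∣Δ∩⊤∣ T) (proj₁ (proj₂ union))

    Z─K⊆T : x ∈ Z → x ∉ K → x ∈ T
    Z─K⊆T {x} x∈Z x∉K = proj₂ (proj₂ (proj₂ union)) x
      (proj₂ (proj₂ (proj₂ (tight-around x))) x∈Z x∉K)

    -- For a circuit `C` through `x`, the independent set `C - x` extends to a basis of `Z`, which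
    -- cannot contain `x` without containing `C`.
    avoiding-basis : x ∈ Z → ∃[ J ] Basis M Z J × x ∉ J
    avoiding-basis {x} x∈Z with C , (circ , C⊆Z) , x∈C ← cyclic⁻ M cyc x∈Z
      with J , C-x⊆J , bas ← extend-to-basis M (C⊆Z ∘ p-x⊆p C x)
             (proj₂ circ (C - x) (x∈p⇒p-x⊂p x∈C)) =
      J , bas , λ x∈J → proj₁ circ (hereditary M
        (λ y∈C → insert-⊆ C-x⊆J x∈J (⊆remove∪ C x y∈C)) (proj₁ (proj₂ bas)))

    -- Inside `T`, tightness gives `J` no more elements than `K`; outside `T`, all of `Z` lies in
    -- `K`, so there `J` is part of `K` and misses `x`.
    no-coloop : x ∈ K → x ∉ T → x ∈ Z → ∀ {J} → Basis M Z J → x ∉ J → ∣ J ∣ < ∣ K ∣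
    no-coloop {x} x∈K x∉T x∈Z {J} (J⊆Z , indJ , _) x∉J = begin-strict
      ∣ J ∣                     ≡⟨ ∣p∩q∣+∣p─q∣≡∣p∣ J T ⟨
      ∣ J ∩ T ∣ + ∣ J ─ T ∣
        ≤⟨ ℕ.+-monoˡ-≤ ∣ J ─ T ∣ (indep⇒∣∣≤∣Δ∣ (hereditary M (p∩q⊆p J T) indJ) (p∩q⊆q J T)) ⟩
      ∣ Δ A T ∣ + ∣ J ─ T ∣
        ≤⟨ ℕ.+-mono-≤ T-tight (p⊆q⇒∣p∣≤∣q∣ J─T⊆) ⟩
      ∣ T ∩ K ∣ + ∣ (K ─ T) - x ∣
        <⟨ ℕ.+-monoʳ-< ∣ T ∩ K ∣ (x∈p⇒∣p-x∣<∣p∣ (x∈p∧x∉q⇒x∈p─q x∈K x∉T)) ⟩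
      ∣ T ∩ K ∣ + ∣ K ─ T ∣     ≡⟨ cong (λ W → ∣ W ∣ + ∣ K ─ T ∣) (∩-comm T K) ⟩
      ∣ K ∩ T ∣ + ∣ K ─ T ∣     ≡⟨ ∣p∩q∣+∣p─q∣≡∣p∣ K T ⟩
      ∣ K ∣                     ∎
      where
      open ℕ.≤-Reasoning
      J─T⊆ : J ─ T ⊆ (K ─ T) - x
      J─T⊆ {y} y∈ = x∈p∧x≢y⇒x∈p-y
        (x∈p∧x∉q⇒x∈p─q
          (decidable-stable (y ∈? K) λ y∉K → y∉T (Z─K⊆T (J⊆Z y∈J) y∉K)) y∉T)
        λ { refl → x∉J y∈J }
        where
        y∈J = p─q⊆p J T y∈
        y∉T : y ∉ T
        y∉T = x∈p─q⇒x∉q J T y∈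

    Z⊆T : Z ⊆ T
    Z⊆T {x} x∈Z with x ∈? K
    ... | no  x∉K = Z─K⊆T x∈Z x∉K
    ... | yes x∈K = decidable-stable (x ∈? T) λ x∉T →
      let J , bas , x∉J = avoiding-basis x∈Z in contradiction
        (no-coloop x∈K x∉T x∈Z bas x∉J)
        (ℕ.≤⇒≯ (ℕ.≤-reflexive (trans ∣K∣≡rank (sym (proj₂ (proj₂ bas))))))

    ∣ΔZ∣≤rank : ∣ Δ A Z ∣ ≤ rank M Z
    ∣ΔZ∣≤rank = begin
      ∣ Δ A Z ∣   ≤⟨ p⊆q⇒∣p∣≤∣q∣ (Δ-mono A Z⊆T) ⟩
      ∣ Δ A T ∣   ≤⟨ T-tight ⟩
      ∣ T ∩ K ∣   ≤⟨ ∣p∩q∣≤∣q∣ T K ⟩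
      ∣ K ∣       ≡⟨ ∣K∣≡rank ⟩
      rank M Z    ∎
      where open ℕ.≤-Reasoning

  ∣⋂Δ∣-single : ∀ {F U} → Cyclic M F → Cyclic M U → ∣⋂Δ∣ A (F ∷ []) U ≡ rank M (F ∪ U)
  ∣⋂Δ∣-single {F} {U} cF cU = trans
    (cong ∣_∣ (trans (cong (_∪ Δ A U) (∩-identityʳ (Δ A F))) (sym (Δ-∪ A F U))))
    (sym (rank-cyclic (cyclic-∪ M cF cU)))

  -- The modular law for `Δ A F ∪ W` and `Q ∪ W`: their intersection is `(Δ A F ∩ Q) ∪ W`, while
  -- their union moves `F` from the family into `U`.
  ∣⋂Δ∣-cons : ∀ {F U} 𝓕 → Cyclic M F → Cyclic M U →
    ∣⋂Δ∣ A 𝓕 (F ∪ U) + ∣⋂Δ∣ A (F ∷ 𝓕) U ≡ rank M (F ∪ U) + ∣⋂Δ∣ A 𝓕 U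
  ∣⋂Δ∣-cons {F} {U} 𝓕 cF cU = begin
    ∣ Q ∪ Δ A (F ∪ U) ∣ + ∣ (Δ A F ∩ Q) ∪ W ∣
      ≡⟨ cong₂ (λ S T → ∣ S ∣ + ∣ T ∣) union (∪-distribʳ-∩ W (Δ A F) Q) ⟩
    ∣ (Δ A F ∪ W) ∪ (Q ∪ W) ∣ + ∣ (Δ A F ∪ W) ∩ (Q ∪ W) ∣
      ≡⟨ ∣p∪q∣+∣p∩q∣≡∣p∣+∣q∣ (Δ A F ∪ W) (Q ∪ W) ⟩
    ∣ Δ A F ∪ W ∣ + ∣ Q ∪ W ∣
      ≡⟨ cong (λ S → ∣ S ∣ + ∣ Q ∪ W ∣) (Δ-∪ A F U) ⟨
    ∣ Δ A (F ∪ U) ∣ + ∣ Q ∪ W ∣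
      ≡⟨ cong (_+ ∣ Q ∪ W ∣) (rank-cyclic (cyclic-∪ M cF cU)) ⟨
    rank M (F ∪ U) + ∣ Q ∪ W ∣ ∎
    where
    open ≡-Reasoning
    Q = ⋂ (map (Δ A) 𝓕)
    W = Δ A U
    union : Q ∪ Δ A (F ∪ U) ≡ (Δ A F ∪ W) ∪ (Q ∪ W)
    union = trans (cong (Q ∪_) (Δ-∪ A F U)) (⊆-antisym
      (∪-least (q⊆p∪q _ _ ∘ p⊆p∪q W) (p⊆p∪q (Q ∪ W)))
      (∪-least (q⊆p∪q Q _) (∪-least (p⊆p∪q _) (q⊆p∪q Q _ ∘ q⊆p∪q (Δ A F) W))))

-- Inclusion–exclusion, one set at a time: unions of cyclic sets are cyclic, so all the
-- cardinalities involved are ranks.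
∣⋂Δ∣-unique : (M : Matroid n) (A : SetSystem n s) (B : SetSystem n t)
  (presA : Presents A M) (presB : Presents B M) →
  ∀ {F U} 𝓕 → Cyclic M F → All (Cyclic M) 𝓕 → Cyclic M U →
  ∣⋂Δ∣ A (F ∷ 𝓕) U ≡ ∣⋂Δ∣ B (F ∷ 𝓕) U
∣⋂Δ∣-unique M A B presA presB [] cF [] cU =
  trans (∣⋂Δ∣-single M A presA cF cU) (sym (∣⋂Δ∣-single M B presB cF cU))
∣⋂Δ∣-unique M A B presA presB {F} {U} (G ∷ 𝓕) cF (cG ∷ c𝓕) cU =
  ℕ.+-cancelˡ-≡ (∣⋂Δ∣ A (G ∷ 𝓕) (F ∪ U)) _ _ $ begin
    ∣⋂Δ∣ A (G ∷ 𝓕) (F ∪ U) + ∣⋂Δ∣ A (F ∷ G ∷ 𝓕) U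
      ≡⟨ ∣⋂Δ∣-cons M A presA (G ∷ 𝓕) cF cU ⟩
    rank M (F ∪ U) + ∣⋂Δ∣ A (G ∷ 𝓕) U
      ≡⟨ cong (rank M (F ∪ U) +_) (∣⋂Δ∣-unique M A B presA presB 𝓕 cG c𝓕 cU) ⟩
    rank M (F ∪ U) + ∣⋂Δ∣ B (G ∷ 𝓕) U
      ≡⟨ ∣⋂Δ∣-cons M B presB (G ∷ 𝓕) cF cU ⟨
    ∣⋂Δ∣ B (G ∷ 𝓕) (F ∪ U) + ∣⋂Δ∣ B (F ∷ G ∷ 𝓕) U
      ≡⟨ cong (_+ ∣⋂Δ∣ B (F ∷ G ∷ 𝓕) U)
           (∣⋂Δ∣-unique M A B presA presB 𝓕 cG c𝓕 (cyclic-∪ M cF cU)) ⟨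
    ∣⋂Δ∣ A (G ∷ 𝓕) (F ∪ U) + ∣⋂Δ∣ B (F ∷ G ∷ 𝓕) U ∎
  where open ≡-Reasoning

-- Rank equality for fundamental transversal matroids.

module _ (M : Matroid n) (A : SetSystem n s) (presA : Presents A M) where

  fundamental⇒rankEquality : Fundamental M →
    ∀ 𝓕 → NonemptyFamilyOfCyclicFlats M 𝓕 → RankEquality M A 𝓕
  fundamental⇒rankEquality _ [] (≢[] , _) = contradiction refl ≢[]
  fundamental⇒rankEquality (t , B , presB , private-element)
    𝓕@(F₀ ∷ 𝓖) (_ , flats@(flat₀ ∷ flats′)) =
    trans (ℕ.≤-antisym rank≤ rank≥) (sym ∣⋂Δ∣-A≡B)
    where
    E : Subset t
    E = ⋂ (map (Δ B) 𝓕)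

    ∣⋂Δ∣-⊥ : ∀ {s} (A : SetSystem n s) → ∣⋂Δ∣ A 𝓕 ⊥ ≡ ∣ ⋂ (map (Δ A) 𝓕) ∣
    ∣⋂Δ∣-⊥ A = cong ∣_∣ (trans (cong (⋂ (map (Δ A) 𝓕) ∪_) (Δ-⊥ A)) (∪-identityʳ _))

    -- Moves the count to the presentation with private elements; the cyclic set `U` is taken to be
    -- empty.
    ∣⋂Δ∣-A≡B : ∣ ⋂ (map (Δ A) 𝓕) ∣ ≡ ∣ E ∣
    ∣⋂Δ∣-A≡B = trans (sym (∣⋂Δ∣-⊥ A)) (trans
      (∣⋂Δ∣-unique M A B presA presB 𝓖 (proj₁ flat₀) (All.map proj₁ flats′) ([] , [] , refl))
      (∣⋂Δ∣-⊥ B))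

    rank≤ : rank M (⋂ 𝓕) ≤ ∣ E ∣
    rank≤ = ℕ.≤-trans (rank≤∣Δ∣ M B presB (⋂ 𝓕)) (p⊆q⇒∣p∣≤∣q∣ (Δ-⋂ B 𝓕))

    b : Fin t → Fin n
    b k = proj₁ (private-element k)

    others : Fin t → List (Fin t)
    others k = filter (λ j → ¬? (j Fin.≟ k)) (allFin t)

    b∈B : ∀ k → b k ∈ B k
    b∈B k = p─q⊆p (B k) (⋃ (map B (others k))) (proj₂ (private-element k))

    b∈B⇒≡ : ∀ {k j} → b k ∈ B j → j ≡ k
    b∈B⇒≡ {k} {j} b∈Bj = decidable-stable (j Fin.≟ k) λ j≢k →
      x∈p─q⇒x∉q (B k) (⋃ (map B (others k))) (proj₂ (private-element k))
        (∈-⋃⁺ (∈-map⁺ B (∈-filter⁺ (λ j → ¬? (j Fin.≟ k)) (∈-allFin j) j≢k)) b∈Bj)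

    b-injective : ∀ {k j} → b k ≡ b j → k ≡ j
    b-injective {k} eq = b∈B⇒≡ (subst (_∈ B k) eq (b∈B k))

    -- Since `b k` lies in `B k` only, `Δ₁ B (b k)` is the single vertex `k` of the simplex.
    IsVertex : Fin n → Set
    IsVertex x = ∃[ k ] k ∈ E × b k ≡ x

    isVertex? : Decidable IsVertex
    isVertex? x = Fin.any? λ k → (k ∈? E) ×-dec (b k Fin.≟ x)

    vertices : Subset n
    vertices = select isVertex?

    vertices-indep : Indep M vertices
    vertices-indep = Equivalence.from (presB vertices)
      (matching⇒transversal B {D = E} record
        { match     = λ x∈ → proj₁ (∈-select⁻ isVertex? x∈)
        ; match∈D   = λ x∈ → proj₁ (proj₂ (∈-select⁻ isVertex? x∈))
        ; ∈match    = λ x∈ → let k , _ , eq = ∈-select⁻ isVertex? x∈ in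
                             subst (_∈ B k) eq (b∈B k)
        ; injective = λ x∈ y∈ eq → let _ , _ , eqx = ∈-select⁻ isVertex? x∈
                                       _ , _ , eqy = ∈-select⁻ isVertex? y∈
                                   in trans (sym eqx) (trans (cong b eq) eqy)
        })

    -- The only index of `b k` is `k`, so adding `b k` leaves `Δ B F` unchanged. As `F` is cyclic,
    -- the size of `Δ B F` is its rank; the rank does not grow, and flatness applies.
    b∈flat : ∀ {F k} → CyclicFlat M F → k ∈ Δ B F → b k ∈ F
    b∈flat {F} {k} (cyc , flat) k∈ = flat (ℕ.≤-antisym
      (begin
        rank M (F ∪ ⁅ b k ⁆)       ≤⟨ rank≤∣Δ∣ M B presB (F ∪ ⁅ b k ⁆) ⟩
        ∣ Δ B (F ∪ ⁅ b k ⁆) ∣      ≤⟨ p⊆q⇒∣p∣≤∣q∣ Δ⊆ ⟩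
        ∣ Δ B F ∣                  ≡⟨ rank-cyclic M B presB cyc ⟨
        rank M F                   ∎)
      (rank-mono M (p⊆p∪q ⁅ b k ⁆)))
      where
      open ℕ.≤-Reasoning
      Δ⊆ : Δ B (F ∪ ⁅ b k ⁆) ⊆ Δ B F
      Δ⊆ {j} j∈ with x , x∈ , x∈Bj ← ∈-Δ⁻ B j∈ with x∈p∪q⁻ F ⁅ b k ⁆ x∈
      ... | inj₁ x∈F = ∈-Δ⁺ B x∈F x∈Bj
      ... | inj₂ x∈b with refl ← x∈⁅y⁆⇒x≡y (b k) x∈b =
        subst (_∈ Δ B F) (sym (b∈B⇒≡ x∈Bj)) k∈

    rank≥ : ∣ E ∣ ≤ rank M (⋂ 𝓕)
    rank≥ = ℕ.≤-trans
      (injection⇒∣p∣≤∣q∣ E vertices (λ k x → b k ≡ x)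
        (λ k∈ → _ , ∈-select⁺ isVertex? (_ , k∈ , refl) , refl)
        (λ eq eq′ → b-injective (trans eq (sym eq′))))
      (rank-max M vertices⊆ vertices-indep)
      where
      vertices⊆ : vertices ⊆ ⋂ 𝓕
      vertices⊆ x∈ with k , k∈E , refl ← ∈-select⁻ isVertex? x∈ = ∈-⋂⁺ 𝓕 λ F∈ →
        b∈flat (All.lookup flats F∈) (∈-⋂⁻ k∈E (∈-map⁺ (Δ B) F∈))

-- A presentation built from a fundamental basis.

module _ (M : Matroid n) {B : Subset n} (indep-B : Indep M B) where

  private
    elements : List (Fin n)
    elements = filter (_∈? B) (allFin n)

    elements-unique : Unique elements
    elements-unique = Unique.filter⁺ (_∈? B) (Unique.allFin⁺ n)

    e : Fin (length elements) → Fin n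
    e = List.lookup elements

    e-injective : ∀ {i j} → e i ≡ e j → i ≡ j
    e-injective = lookup-injective elements-unique _ _

    e∈B : ∀ i → e i ∈ B
    e∈B i = proj₂ (∈-filter⁻ (_∈? B) {xs = allFin n} (∈-lookup i))

    e-onto : x ∈ B → ∃[ i ] e i ≡ x
    e-onto {x} x∈B = index x∈ , sym (lookup-index x∈)
      where
      x∈ : x ∈ˡ elements
      x∈ = ∈-filter⁺ (_∈? B) (∈-allFin x) x∈B

    -- For a basis `B` these `x` form the fundamental cocircuit of `b`. The first condition excludes
    -- the other elements of `B`, for which the second holds trivially.
    Exchange : Fin n → Fin n → Set
    Exchange b x = x ∉ B - b × Indep M ((B - b) ∪ ⁅ x ⁆)

    exchange? : ∀ b → Decidable (Exchange b)
    exchange? b x = ¬? (x ∈? B - b) ×-dec indep? M ((B - b) ∪ ⁅ x ⁆)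

    system : SetSystem n (length elements)
    system i = select (exchange? (e i))

    ∈system⁻ : ∀ {i} → x ∈ system i → Exchange (e i) x
    ∈system⁻ {i = i} = ∈-select⁻ (exchange? (e i))

    e∈system : ∀ i → e i ∈ system i
    e∈system i = ∈-select⁺ (exchange? (e i))
      (x∉p-x B (e i) , hereditary M (insert-⊆ (p-x⊆p B (e i)) (e∈B i)) indep-B)

    e∈system⇒≡ : ∀ {i j} → e i ∈ system j → j ≡ i
    e∈system⇒≡ {i} {j} ei∈ = e-injective (decidable-stable (e j Fin.≟ e i) λ ≢ →
      proj₁ (∈system⁻ ei∈) (x∈p∧x≢y⇒x∈p-y (e∈B i) (≢ ∘ sym)))

  module _ (rank≤∣B∣ : rank M ⊤ ≤ ∣ B ∣) where

    private
      Supports : Subset n → Fin n → Set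
      Supports X x = ∃[ i ] i ∈ Δ system X × e i ≡ x

      supports? : ∀ X → Decidable (Supports X)
      supports? X x = Fin.any? λ i → (i ∈? Δ system X) ×-dec (e i Fin.≟ x)

      -- As `B` is a basis, this is the least subset of `B` whose closure contains `X`.
      support : Subset n → Subset n
      support X = select (supports? X)

      support⊆B : support X ⊆ B
      support⊆B {X = X} x∈ with i , _ , refl ← ∈-select⁻ (supports? X) x∈ = e∈B i

      ∣support∣≤ : ∀ X → ∣ support X ∣ ≤ ∣ Δ system X ∣
      ∣support∣≤ X = injection⇒∣p∣≤∣q∣ (support X) (Δ system X) (λ x i → e i ≡ x)
        (λ x∈ → let i , i∈ , eq = ∈-select⁻ (supports? X) x∈ in i , i∈ , eq)
        (λ eq eq′ → trans (sym eq) eq′)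

      -- X lies in the closure of its support: otherwise the support and some x ∈ X extend
      -- within B ∪ ⁅ x ⁆ to a basis, which trades for x an element outside the support.
      hall : Indep M X → ∣ X ∣ ≤ ∣ support X ∣
      hall {X} indX = ℕ.≮⇒≥ λ lt →
        let x , x∈X , x∉S , indSx =
              augment M (hereditary M (support⊆B {X = X}) indep-B) indX lt
        in exchange x∈X x∉S indSx (x ∈? B)
        where
        support⁺ : ∀ {i} → x ∈ X → x ∈ system i → e i ∈ support X
        support⁺ x∈X x∈ = ∈-select⁺ (supports? X) (_ , ∈-Δ⁺ system x∈X x∈ , refl)

        exchange : x ∈ X → x ∉ support X → Indep M (support X ∪ ⁅ x ⁆) → ¬ Dec (x ∈ B)
        exchange x∈X x∉S _ (yes x∈B) with i , refl ← e-onto x∈B =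
          x∉S (support⁺ x∈X (e∈system i))
        exchange {x} x∈X x∉S indSx (no x∉B)
          with J , S⊆J , J⊆Bx , indJ , ∣J∣≡ ←
                 extend-to-basis M (∪-mono (support⊆B {X = X}) id) indSx =
          b∉J (S⊆J (p⊆p∪q ⁅ x ⁆ (support⁺ x∈X x∈system)))
          where
          ∣B∣≤∣J∣ : ∣ B ∣ ≤ ∣ J ∣
          ∣B∣≤∣J∣ = subst (∣ B ∣ ≤_) (sym ∣J∣≡) (rank-max M (p⊆p∪q ⁅ x ⁆) indep-B)

          -- If `J` contained `B`, then `B ∪ ⁅ x ⁆` would be independent and larger than the rank.
          missing : ∃[ i ] e i ∉ J
          missing with Fin.any? (λ i → ¬? (e i ∈? J))
          ... | yes found = found
          ... | no  none = contradiction
            (ℕ.<-≤-trans (∣insert∣> x∉B) (ℕ.≤-trans (rank-max M ⊆⊤ indBx) rank≤∣B∣))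
            (ℕ.<-irrefl refl)
            where
            B⊆J : B ⊆ J
            B⊆J y∈B with i , refl ← e-onto y∈B =
              decidable-stable (e i ∈? J) λ e∉J → none (i , e∉J)

            indBx : Indep M (B ∪ ⁅ x ⁆)
            indBx = hereditary M (insert-⊆ B⊆J (S⊆J (x∈insert _ x))) indJ

          i = proj₁ missing
          b∉J = proj₂ missing

          J⊆ : J ⊆ (B - e i) ∪ ⁅ x ⁆
          J⊆ {y} y∈J with x∈p∪q⁻ B ⁅ x ⁆ (J⊆Bx y∈J)
          ... | inj₁ y∈B = p⊆p∪q ⁅ x ⁆ (x∈p∧x≢y⇒x∈p-y y∈B λ { refl → b∉J y∈J })
          ... | inj₂ y∈x = q⊆p∪q (B - e i) ⁅ x ⁆ y∈x

          -- By cardinality `J` fills `(B - e i) ∪ ⁅ x ⁆`, which is therefore independent. So `e i`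
          -- belongs to the support and hence to `J`, from which it was chosen to be missing.
          x∈system : x ∈ system i
          x∈system = ∈-select⁺ (exchange? (e i))
            ( x∉B ∘ p-x⊆p B (e i)
            , hereditary M
                (⊆∧∣∣≥⇒⊇ J⊆ (ℕ.≤-trans (∣insert∣≤ (B - e i) x)
                  (ℕ.≤-trans (x∈p⇒∣p-x∣<∣p∣ (e∈B i)) ∣B∣≤∣J∣)))
                indJ )

    module _ (spanning : ∀ {F} → CyclicFlat M F → rank M F ≤ ∣ B ∩ F ∣) where

      private
        -- If `e i` were outside `F`, then `B ∩ F` would lie in `B - e i`, and adding `x` would give
        -- an independent subset of `F` larger than its rank.
        e∈flat : ∀ {F i} → CyclicFlat M F → x ∈ F → x ∈ system i → e i ∈ F
        e∈flat {x} {F} {i} flat x∈F x∈i with x∉ , ind ← ∈system⁻ x∈i =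
          decidable-stable (e i ∈? F) λ e∉F →
            let ⊆B-e : B ∩ F ⊆ B - e i
                ⊆B-e y∈ = let y∈B , y∈F = x∈p∩q⁻ B F y∈ in
                  x∈p∧x≢y⇒x∈p-y y∈B λ { refl → e∉F y∈F }
            in contradiction
              (ℕ.<-≤-trans (∣insert∣> (x∉ ∘ ⊆B-e))
                (rank-max M (insert-⊆ (p∩q⊆q B F) x∈F) (hereditary M (∪-mono ⊆B-e id) ind)))
              (ℕ.≤⇒≯ (spanning flat))

        -- For a circuit `C` in `I` with closure `F`, `e∈flat` makes the matching inject `C` into
        -- `B ∩ F`. That set has at most rank-many elements, and the rank of `F` is the rank of `C`,
        -- less than `∣ C ∣`.
        transversal⇒indep : PartialTransversal system I → Indep M I
        transversal⇒indep {I} pt = decidable-stable (indep? M I) λ dep →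
          let C , C⊆I , circ = dependent⇒circuit M dep
              F = closure M C
              flat = closure-circuit M circ
              open Matching (transversal⇒matching system pt ⊆-refl)
          in contradiction
            (ℕ.≤-trans
              (injection⇒∣p∣≤∣q∣ C (B ∩ F) (λ x b → ∃[ i ] e i ≡ b × Matched x i)
                (λ x∈C → let x∈I = C⊆I x∈C in
                  _ , x∈p∩q⁺ (e∈B _ , e∈flat flat (⊆-closure M x∈C) (∈match x∈I)) ,
                  match x∈I , refl , x∈I , refl)
                λ (i , eq , r) (j , eq′ , r′) → Matched-injective r
                  (subst (Matched _) (sym (e-injective (trans eq (sym eq′)))) r′))
              (rank-max M (p∩q⊆q B F) (hereditary M (p∩q⊆p B F) indep-B)))
            (ℕ.<⇒≱ (subst (_< ∣ C ∣) (sym (rank-closure M C)) (dependent⇒rank< M (proj₁ circ))))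

      fundamental-basis⇒fundamental : Fundamental M
      fundamental-basis⇒fundamental = length elements , system ,
        (λ I → mk⇔ (λ ind → hall⇒transversal system λ {X} X⊆I →
                 ℕ.≤-trans (hall (hereditary M X⊆I ind)) (∣support∣≤ X))
               transversal⇒indep) ,
        λ i → e i , x∈p∧x∉q⇒x∈p─q (e∈system i) (e∉others i)
        where
        e∉others : ∀ i → e i ∉ ⋃ (map system (filter (λ j → ¬? (j Fin.≟ i)) (allFin _)))
        e∉others i e∈
          with _ , S∈ , e∈S ← ∈-⋃⁻ (map system (filter (λ j → ¬? (j Fin.≟ i)) (allFin _))) e∈
          with j , j∈ , refl ← ∈-map⁻ system S∈ =
          proj₂ (∈-filter⁻ (λ j → ¬? (j Fin.≟ i)) {xs = allFin _} j∈) (e∈system⇒≡ e∈S)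

-- Stars of vertices and their representatives.

module _ (M : Matroid n) (A : SetSystem n s) where

  private
    InStar : Fin s → Pred (Subset n) 0ℓ
    InStar k F = CyclicFlat M F × k ∈ Δ A F

    inStar? : ∀ k → Decidable (InStar k)
    inStar? k F = cyclicFlat? M F ×-dec (k ∈? Δ A F)

  star : Fin s → Family n
  star k = filter (inStar? k) (subsets n)

  ∈-star⁺ : ∀ {k F} → CyclicFlat M F → k ∈ Δ A F → F ∈ˡ star k
  ∈-star⁺ {k} {F} flat k∈ = ∈-filter⁺ (inStar? k) (∈-subsets F) (flat , k∈)

  ∈-star⁻ : ∀ {k F} → F ∈ˡ star k → CyclicFlat M F × k ∈ Δ A F
  ∈-star⁻ {k} F∈ = proj₂ (∈-filter⁻ (inStar? k) {xs = subsets n} F∈)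

  -- All stars are filtered from the one list `subsets n`, so equal members give equal lists, along
  -- which `represents-functional` can transport the chosen matching.
  star-cong : ∀ {j k} → (∀ {F} → InStar j F → InStar k F) →
              (∀ {F} → InStar k F → InStar j F) → star j ≡ star k
  star-cong {j} {k} to from = List.filter-≐ (inStar? j) (inStar? k) (to , from) (subsets n)

  star-flats : ∀ k → All (CyclicFlat M) (star k)
  star-flats k = All.map proj₁ (All.all-filter (inStar? k) (subsets n))

  star-filter : ∀ k → IsFilter M (star k)
  star-filter k F∈ flat F⊆G = ∈-star⁺ flat (Δ-mono A F⊆G (proj₂ (∈-star⁻ F∈)))

  -- One matching is fixed for each family, so that vertices with equal stars share it and
  -- are therefore represented by distinct elements.
  module _ (pres : Presents A M) (equality : ∀ k → star k ≢ [] → RankEquality M A (star k)) where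

    private
      meetBasis : Family n → Subset n
      meetBasis 𝓕 = proj₁ (basis M (⋂ 𝓕))

      meetBasis-isBasis : ∀ 𝓕 → Basis M (⋂ 𝓕) (meetBasis 𝓕)
      meetBasis-isBasis 𝓕 = proj₂ (basis M (⋂ 𝓕))

      μ : ∀ 𝓕 → Matching A (meetBasis 𝓕) (Δ A (⋂ 𝓕))
      μ 𝓕 = let K⊆ , ind , _ = meetBasis-isBasis 𝓕 in
        transversal⇒matching A (Equivalence.to (pres (meetBasis 𝓕)) ind) K⊆

      Represents : Fin n → Fin s → Set
      Represents x k = Matching.Matched (μ (star k)) x k

      represents-injective : ∀ {k} → Represents x k → Represents y k → x ≡ y
      represents-injective {k = k} = Matching.Matched-injective (μ (star k))

      star-nonempty : ∀ {k F} → F ∈ˡ star k → star k ≢ []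
      star-nonempty F∈ eq with () ← subst (_ ∈ˡ_) eq F∈

      -- The rank of `⋂ 𝓕` is at most the size of `Δ A (⋂ 𝓕)`, which lies in the intersection of the
      -- `Δ A F`. Rank equality closes this chain, so both sets coincide and the matching of a basis
      -- reaches every index, `k` included.
      represented : ∀ {k F} → CyclicFlat M F → k ∈ Δ A F → ∃[ x ] x ∈ F × Represents x k
      represented {k} {F} flat k∈ =
        let x , r = Matching.onto (μ 𝓕) (ℕ.≤-trans (p⊆q⇒∣p∣≤∣q∣ Δ⋂⊆) (ℕ.≤-reflexive
                      (trans (sym ∣⋂∣) (sym ∣K∣≡)))) (⋂Δ⊆ k∈⋂Δ)
        in x , ∈-⋂⁻ (K⊆ (proj₁ r)) F∈ , r
        where
        𝓕 = star k

        F∈ : F ∈ˡ 𝓕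
        F∈ = ∈-star⁺ flat k∈

        K⊆ : meetBasis 𝓕 ⊆ ⋂ 𝓕
        K⊆ = proj₁ (meetBasis-isBasis 𝓕)

        ∣K∣≡ : ∣ meetBasis 𝓕 ∣ ≡ rank M (⋂ 𝓕)
        ∣K∣≡ = proj₂ (proj₂ (meetBasis-isBasis 𝓕))

        ∣⋂∣ : rank M (⋂ 𝓕) ≡ ∣ ⋂ (map (Δ A) 𝓕) ∣
        ∣⋂∣ = equality k (star-nonempty F∈)

        Δ⋂⊆ : Δ A (⋂ 𝓕) ⊆ ⋂ (map (Δ A) 𝓕)
        Δ⋂⊆ = Δ-⋂ A 𝓕

        ⋂Δ⊆ : ⋂ (map (Δ A) 𝓕) ⊆ Δ A (⋂ 𝓕)
        ⋂Δ⊆ = ⊆∧∣∣≥⇒⊇ Δ⋂⊆ (subst (_≤ ∣ Δ A (⋂ 𝓕) ∣) ∣⋂∣ (rank≤∣Δ∣ M A pres (⋂ 𝓕)))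

        k∈⋂Δ : k ∈ ⋂ (map (Δ A) 𝓕)
        k∈⋂Δ = ∈-⋂⁺ (map (Δ A) 𝓕) λ D∈ → let G , G∈ , D≡ = ∈-map⁻ (Δ A) D∈ in
          subst (k ∈_) (sym D≡) (proj₂ (∈-star⁻ G∈))

      represents∈⇒ : ∀ {k F} → Represents x k → x ∈ F → k ∈ Δ A F
      represents∈⇒ {k = k} r x∈F = ∈-Δ⁺ A x∈F (Matching.Matched⇒∈ (μ (star k)) r)

      represents⇒∈ : ∀ {k F} → Represents x k → F ∈ˡ star k → x ∈ F
      represents⇒∈ {k = k} (x∈K , _) F∈ =
        ∈-⋂⁻ (proj₁ (meetBasis-isBasis (star k)) x∈K) F∈

      -- A cyclic flat contains `x` exactly when it belongs to the star of `j`, and likewise for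
      -- `k`. So the stars agree, and `j` and `k` are partners of `x` in the same matching.
      represents-functional : ∀ {j k} → Represents x j → Represents x k → j ≡ k
      represents-functional {x} {j} {k} r r′ = Matching.Matched-functional (μ (star k))
        (subst (λ 𝓕 → Matching.Matched (μ 𝓕) x j) star≡ r) r′
        where
        inStar : ∀ {j k F} → Represents x j → Represents x k → InStar j F → InStar k F
        inStar r r′ (flat , j∈) = flat , represents∈⇒ r′ (represents⇒∈ r (∈-star⁺ flat j∈))

        star≡ : star j ≡ star k
        star≡ = star-cong (inStar r r′) (inStar r′ r)

      -- A vertex with empty star may be represented as well, since `⋂ []` is `⊤`; its
      -- representative lies in no cyclic flat.
      Representative : Fin n → Set
      Representative x = ∃[ k ] Represents x k

      representative? : Decidable Representative
      representative? x = Fin.any? λ k → Matching.matched? (μ (star k)) k x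

      representatives : Subset n
      representatives = select representative?

      -- The elements of a circuit `C` of representatives have distinct vertices in `Δ A F`, where
      -- `F` is the closure of `C`. But `Δ A F` has only as many vertices as the rank of `C`.
      representatives-indep : Indep M representatives
      representatives-indep = decidable-stable (indep? M representatives) λ dep →
        let C , C⊆ , circ = dependent⇒circuit M dep
            F = closure M C
        in contradiction
          (ℕ.≤-trans
            (injection⇒∣p∣≤∣q∣ C (Δ A F) Represents
              (λ x∈C → let k , r = ∈-select⁻ representative? (C⊆ x∈C) in
                k , represents∈⇒ r (⊆-closure M x∈C) , r)
              represents-injective)
            (ℕ.≤-reflexive (trans
              (sym (rank-cyclic M A pres (proj₁ (closure-circuit M circ))))
              (rank-closure M C))))
          (ℕ.<⇒≱ (dependent⇒rank< M (proj₁ circ)))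

    star-equality⇒fundamental : Fundamental M
    star-equality⇒fundamental =
      let B , ⊆B , _ , indep-B , ∣B∣≡ = extend-to-basis M ⊆⊤ representatives-indep
      in fundamental-basis⇒fundamental M indep-B (ℕ.≤-reflexive (sym ∣B∣≡)) (spanning ⊆B)
      where
      open ℕ.≤-Reasoning
      spanning : ∀ {B F} → representatives ⊆ B → CyclicFlat M F → rank M F ≤ ∣ B ∩ F ∣
      spanning {B} {F} ⊆B flat = begin
        rank M F      ≡⟨ rank-cyclic M A pres (proj₁ flat) ⟩
        ∣ Δ A F ∣     ≤⟨ injection⇒∣p∣≤∣q∣ (Δ A F) (B ∩ F) (λ k x → Represents x k)
                           (λ k∈ → let x , x∈F , r = represented flat k∈ in
                             x , x∈p∩q⁺ (⊆B (∈-select⁺ representative? (_ , r)) , x∈F) , r)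
                           represents-functional ⟩
        ∣ B ∩ F ∣     ∎

-- Minimal members and the reduction to antichains.

module _ (𝓕 : Family n) where

  private
    hasSmaller? : ∀ F → Dec (Any (_⊂ F) 𝓕)
    hasSmaller? F = Any.any? (_⊂? F) 𝓕

    isMinimal? : Decidable (λ F → ¬ Any (_⊂ F) 𝓕)
    isMinimal? F = ¬? (hasSmaller? F)

  minimals : Family n
  minimals = filter isMinimal? 𝓕

  minimals⊆ : ∀ {F} → F ∈ˡ minimals → F ∈ˡ 𝓕
  minimals⊆ F∈ = proj₁ (∈-filter⁻ isMinimal? F∈)

  minimals-antichain : IsAntichain minimals
  minimals-antichain {F} {G} F∈ G∈ F⊆G = ⊆-antisym F⊆G λ {x} x∈G →
    decidable-stable (x ∈? F) λ x∉F →
      proj₂ (∈-filter⁻ isMinimal? {xs = 𝓕} G∈) (lose (minimals⊆ F∈) (F⊆G , x , x∈G , x∉F))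

  minimal-below : ∀ {F} → F ∈ˡ 𝓕 → ∃[ G ] G ∈ˡ minimals × G ⊆ F
  minimal-below {F} = go ∣ F ∣ ℕ.≤-refl
    where
    go : ∀ {F} m → ∣ F ∣ ≤ m → F ∈ˡ 𝓕 → ∃[ G ] G ∈ˡ minimals × G ⊆ F
    go {F} m bound F∈ with hasSmaller? F
    ... | no minimal = F , ∈-filter⁺ isMinimal? F∈ minimal , id
    ... | yes smaller with G , G∈ , G⊂F ← find smaller with m
    ... | zero = contradiction (ℕ.<-≤-trans (p⊂q⇒∣p∣<∣q∣ G⊂F) bound) ℕ.n≮0
    ... | suc m
      with H , H∈ , H⊆G ← go m (s≤s⁻¹ (ℕ.≤-trans (p⊂q⇒∣p∣<∣q∣ G⊂F) bound)) G∈ =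
      H , H∈ , λ x∈ → proj₁ G⊂F (H⊆G x∈)

  -- Every member lies above a minimal one, so by monotonicity the other members do not shrink the
  -- intersection. Taking `f` to be `id` and `Δ A` covers both sides of the rank equality.
  ⋂-minimals : {f : Subset n → Subset s} → (∀ {X Y} → X ⊆ Y → f X ⊆ f Y) →
    ⋂ (map f minimals) ≡ ⋂ (map f 𝓕)
  ⋂-minimals {f = f} mono = ⊆-antisym
    (λ x∈ → ∈-⋂⁺ (map f 𝓕) λ D∈ → let F , F∈ , D≡ = ∈-map⁻ f D∈
                                      G , G∈ , G⊆F = minimal-below F∈
      in subst (_ ∈_) (sym D≡) (mono G⊆F (∈-⋂⁻ x∈ (∈-map⁺ f G∈))))
    (λ x∈ → ∈-⋂⁺ (map f minimals) λ D∈ → let F , F∈ , D≡ = ∈-map⁻ f D∈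
      in subst (_ ∈_) (sym D≡) (∈-⋂⁻ x∈ (∈-map⁺ f (minimals⊆ F∈))))

antichains⇒all : (M : Matroid n) (A : SetSystem n s) →
  (∀ 𝓕 → NonemptyFamilyOfCyclicFlats M 𝓕 → IsAntichain 𝓕 → RankEquality M A 𝓕) →
  ∀ 𝓕 → NonemptyFamilyOfCyclicFlats M 𝓕 → RankEquality M A 𝓕
antichains⇒all M A antichains 𝓕 (𝓕≢[] , flats) = begin
  rank M (⋂ 𝓕)                         ≡⟨ cong (rank M ∘ ⋂) (List.map-id 𝓕) ⟨
  rank M (⋂ (map id 𝓕))                ≡⟨ cong (rank M) (⋂-minimals 𝓕 {f = id} id) ⟨
  rank M (⋂ (map id (minimals 𝓕)))     ≡⟨ cong (rank M ∘ ⋂) (List.map-id (minimals 𝓕)) ⟩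
  rank M (⋂ (minimals 𝓕))
    ≡⟨ antichains (minimals 𝓕)
         (nonempty 𝓕 𝓕≢[] , All.tabulate (All.lookup flats ∘ minimals⊆ 𝓕))
         (minimals-antichain 𝓕) ⟩
  ∣ ⋂ (map (Δ A) (minimals 𝓕)) ∣       ≡⟨ cong ∣_∣ (⋂-minimals 𝓕 (Δ-mono A)) ⟩
  ∣ ⋂ (map (Δ A) 𝓕) ∣                  ∎
  where
  open ≡-Reasoning
  nonempty : ∀ 𝓕 → 𝓕 ≢ [] → minimals 𝓕 ≢ []
  nonempty []       𝓕≢[] _  = 𝓕≢[] refl
  nonempty (F ∷ 𝓖) _    eq with G , G∈ , _ ← minimal-below (F ∷ 𝓖) (here refl)
    with () ← subst (G ∈ˡ_) eq G∈

corollary4p6 : ∀ {n s : ℕ} (M : Matroid n) (A : SetSystem n s) → Presents A M →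
    (Fundamental M ⇔
    (∀ 𝓕 → NonemptyFamilyOfCyclicFlats M 𝓕 → RankEquality M A 𝓕))
    × (Fundamental M ⇔
    (∀ 𝓕 → NonemptyFamilyOfCyclicFlats M 𝓕 → IsFilter M 𝓕 → RankEquality M A 𝓕))
    × (Fundamental M ⇔
    (∀ 𝓕 → NonemptyFamilyOfCyclicFlats M 𝓕 → IsAntichain 𝓕 → RankEquality M A 𝓕))
corollary4p6 M A pres =
    mk⇔ equality all⇒
  , mk⇔ (λ fund 𝓕 flats _ → equality fund 𝓕 flats)
        -- The converse uses the equality for stars only, and stars are filters.
        (λ filters → star-equality⇒fundamental M A pres λ k k≢[] →
           filters (star M A k) (k≢[] , star-flats M A k) λ {F} {G} → star-filter M A k {F} {G})
  , mk⇔ (λ fund 𝓕 flats _ → equality fund 𝓕 flats) (all⇒ ∘ antichains⇒all M A)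
  where
  equality = fundamental⇒rankEquality M A pres

  all⇒ : (∀ 𝓕 → NonemptyFamilyOfCyclicFlats M 𝓕 → RankEquality M A 𝓕) → Fundamental M
  all⇒ h = star-equality⇒fundamental M A pres λ k k≢[] →
    h (star M A k) (k≢[] , star-flats M A k)
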